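{- The theory $P\Sigma_1$ can be axiomatized by a set of $\Pi_3$ sentences, and this is optimal: $P\Sigma_1$ cannot be axiomatized (over $P^-$) by a set of $\Sigma_3$ sentences, i.e. it is not $\Delta_3$-axiomatizable over $P^-$.
   Context: $P^-$ is Peano arithmetic without induction; $I\Sigma_1$ is $P^-$ plus induction for $\Sigma_1$-formulas. Finite sequences are coded by numbers; $\mathrm{lth}(s)$ is the length of the sequence coded by $s$ and $(s)_i$ its $i$-th entry. For a formula $\phi(x,y)$ (possibly with parameters), $\mathsf{PFUN}(\phi)$ states that for every $x$ there is at most one $y$ with $\phi(x,y)$; $\mathsf{Approx}_\phi(s)$ states that $s$ codes a finite sequence with: for all $i<\mathrm{lth}(s)-1$ and all $x,y$, if $x\le (s)_i$ and $\phi(x,y)$ then $y\le (s)_{i+1}$. $P\phi$ is $\mathsf{PFUN}(\phi)\to\forall z\,\exists s\,(\mathsf{Approx}_\phi(s)\wedge \mathrm{lth}(s)=z)$, and $P\Sigma_1$ is $I\Sigma_1$ together with all $P\phi$ for $\phi\in\Sigma_1$. -}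

module Defs where

open import Data.Nat using (ℕ; zero; suc; _+_)
open import Data.Fin using (Fin; zero; suc)
open import Data.List using (List; []; _∷_; map)
open import Data.List.Membership.Propositional using (_∈_)
open import Data.List.Relation.Unary.All using (All)
open import Data.Product using (Σ; _×_; _,_)
open import Data.Sum using (_⊎_)

-- Syntax of first-order arithmetic in the language {0, 1, +, ·, <, =}
-- (scoped de Bruijn: Term n / Formula n have n free variables,
--  var zero = innermost bound variable)

infixl 7 _⊗_
infixl 6 _⊕_
infix  4 _≐_ _≺_
infixr 3 _∧'_
infixr 2 _∨'_
infixr 1 _⇒_

data Term (n : ℕ) : Set where
  var  : Fin n → Term n
  zer  : Term n
  one  : Term n
  _⊕_  : Term n → Term n → Term n
  _⊗_  : Term n → Term n → Term n

data Formula (n : ℕ) : Set where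
  ⊥'   : Formula n
  _≐_  : Term n → Term n → Formula n
  _≺_  : Term n → Term n → Formula n
  _∧'_ : Formula n → Formula n → Formula n
  _∨'_ : Formula n → Formula n → Formula n
  _⇒_  : Formula n → Formula n → Formula n
  ∀'   : Formula (suc n) → Formula n
  ∃'   : Formula (suc n) → Formula n

¬' : ∀ {n} → Formula n → Formula n
¬' φ = φ ⇒ ⊥'

liftR : ∀ {m n} → (Fin m → Fin n) → Fin (suc m) → Fin (suc n)
liftR ρ zero    = zero
liftR ρ (suc i) = suc (ρ i)

renT : ∀ {m n} → (Fin m → Fin n) → Term m → Term n
renT ρ (var i) = var (ρ i)
renT ρ zer     = zer
renT ρ one     = one
renT ρ (s ⊕ t) = renT ρ s ⊕ renT ρ t
renT ρ (s ⊗ t) = renT ρ s ⊗ renT ρ t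

renF : ∀ {m n} → (Fin m → Fin n) → Formula m → Formula n
renF ρ ⊥'       = ⊥'
renF ρ (s ≐ t)  = renT ρ s ≐ renT ρ t
renF ρ (s ≺ t)  = renT ρ s ≺ renT ρ t
renF ρ (φ ∧' ψ) = renF ρ φ ∧' renF ρ ψ
renF ρ (φ ∨' ψ) = renF ρ φ ∨' renF ρ ψ
renF ρ (φ ⇒ ψ)  = renF ρ φ ⇒ renF ρ ψ
renF ρ (∀' φ)   = ∀' (renF (liftR ρ) φ)
renF ρ (∃' φ)   = ∃' (renF (liftR ρ) φ)

wkT : ∀ {n} → Term n → Term (suc n)
wkT = renT suc

wkF : ∀ {n} → Formula n → Formula (suc n)
wkF = renF suc

liftS : ∀ {m n} → (Fin m → Term n) → Fin (suc m) → Term (suc n)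
liftS σ zero    = var zero
liftS σ (suc i) = wkT (σ i)

subT : ∀ {m n} → (Fin m → Term n) → Term m → Term n
subT σ (var i) = σ i
subT σ zer     = zer
subT σ one     = one
subT σ (s ⊕ t) = subT σ s ⊕ subT σ t
subT σ (s ⊗ t) = subT σ s ⊗ subT σ t

subF : ∀ {m n} → (Fin m → Term n) → Formula m → Formula n
subF σ ⊥'       = ⊥'
subF σ (s ≐ t)  = subT σ s ≐ subT σ t
subF σ (s ≺ t)  = subT σ s ≺ subT σ t
subF σ (φ ∧' ψ) = subF σ φ ∧' subF σ ψ
subF σ (φ ∨' ψ) = subF σ φ ∨' subF σ ψ
subF σ (φ ⇒ ψ)  = subF σ φ ⇒ subF σ ψ
subF σ (∀' φ)   = ∀' (subF (liftS σ) φ)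
subF σ (∃' φ)   = ∃' (subF (liftS σ) φ)

_▸_ : ∀ {m n} → Term n → (Fin m → Term n) → Fin (suc m) → Term n
(t ▸ σ) zero    = t
(t ▸ σ) (suc i) = σ i

_[_] : ∀ {n} → Formula (suc n) → Term n → Formula n
φ [ t ] = subF (t ▸ var) φ

close : (n : ℕ) → Formula n → Formula 0
close zero    φ = φ
close (suc n) φ = close n (∀' φ)

v0 : ∀ {m} → Term (suc m)
v0 = var zero
v1 : ∀ {m} → Term (suc (suc m))
v1 = var (suc zero)
v2 : ∀ {m} → Term (suc (suc (suc m)))
v2 = var (suc (suc zero))
v3 : ∀ {m} → Term (suc (suc (suc (suc m))))
v3 = var (suc (suc (suc zero)))
v4 : ∀ {m} → Term (suc (suc (suc (suc (suc m)))))
v4 = var (suc (suc (suc (suc zero))))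
v5 : ∀ {m} → Term (suc (suc (suc (suc (suc (suc m))))))
v5 = var (suc (suc (suc (suc (suc zero)))))
v6 : ∀ {m} → Term (suc (suc (suc (suc (suc (suc (suc m)))))))
v6 = var (suc (suc (suc (suc (suc (suc zero))))))

data Δ₀ {n : ℕ} : Formula n → Set where
  d⊥   : Δ₀ ⊥'
  d≐   : ∀ s t → Δ₀ (s ≐ t)
  d≺   : ∀ s t → Δ₀ (s ≺ t)
  d∧   : ∀ {φ ψ} → Δ₀ φ → Δ₀ ψ → Δ₀ (φ ∧' ψ)
  d∨   : ∀ {φ ψ} → Δ₀ φ → Δ₀ ψ → Δ₀ (φ ∨' ψ)
  d⇒   : ∀ {φ ψ} → Δ₀ φ → Δ₀ ψ → Δ₀ (φ ⇒ ψ)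
  d∀<  : ∀ (t : Term n) {φ} → Δ₀ φ → Δ₀ (∀' (v0 ≺ wkT t ⇒ φ))
  d∃<  : ∀ (t : Term n) {φ} → Δ₀ φ → Δ₀ (∃' (v0 ≺ wkT t ∧' φ))

mutual
  data SigmaF : ℕ → {n : ℕ} → Formula n → Set where
    σ₀ : ∀ {n} {φ : Formula n} → Δ₀ φ → SigmaF 0 φ
    σΠ : ∀ {k n} {φ : Formula n} → PiF k φ → SigmaF (suc k) φ
    σ∃ : ∀ {k n} {φ : Formula (suc n)} → SigmaF (suc k) φ → SigmaF (suc k) (∃' φ)

  data PiF : ℕ → {n : ℕ} → Formula n → Set where
    π₀ : ∀ {n} {φ : Formula n} → Δ₀ φ → PiF 0 φ
    πΣ : ∀ {k n} {φ : Formula n} → SigmaF k φ → PiF (suc k) φ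
    π∀ : ∀ {k n} {φ : Formula (suc n)} → PiF (suc k) φ → PiF (suc k) (∀' φ)

infix 0 _⊢_

data _⊢_ {n : ℕ} (Γ : List (Formula n)) : Formula n → Set where
  hyp  : ∀ {φ} → φ ∈ Γ → Γ ⊢ φ
  ⊥E   : ∀ {φ} → Γ ⊢ ⊥' → Γ ⊢ φ
  raa  : ∀ {φ} → (¬' φ ∷ Γ) ⊢ ⊥' → Γ ⊢ φ
  ⇒I   : ∀ {φ ψ} → (φ ∷ Γ) ⊢ ψ → Γ ⊢ φ ⇒ ψ
  ⇒E   : ∀ {φ ψ} → Γ ⊢ φ ⇒ ψ → Γ ⊢ φ → Γ ⊢ ψ
  ∧I   : ∀ {φ ψ} → Γ ⊢ φ → Γ ⊢ ψ → Γ ⊢ φ ∧' ψ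
  ∧E₁  : ∀ {φ ψ} → Γ ⊢ φ ∧' ψ → Γ ⊢ φ
  ∧E₂  : ∀ {φ ψ} → Γ ⊢ φ ∧' ψ → Γ ⊢ ψ
  ∨I₁  : ∀ {φ ψ} → Γ ⊢ φ → Γ ⊢ φ ∨' ψ
  ∨I₂  : ∀ {φ ψ} → Γ ⊢ ψ → Γ ⊢ φ ∨' ψ
  ∨E   : ∀ {φ ψ χ} → Γ ⊢ φ ∨' ψ → (φ ∷ Γ) ⊢ χ → (ψ ∷ Γ) ⊢ χ → Γ ⊢ χ
  ∀I   : ∀ {φ} → map wkF Γ ⊢ φ → Γ ⊢ ∀' φ
  ∀E   : ∀ {φ} → Γ ⊢ ∀' φ → (t : Term n) → Γ ⊢ φ [ t ]
  ∃I   : ∀ {φ} (t : Term n) → Γ ⊢ φ [ t ] → Γ ⊢ ∃' φ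
  ∃E   : ∀ {φ χ} → Γ ⊢ ∃' φ → (φ ∷ map wkF Γ) ⊢ wkF χ → Γ ⊢ χ
  ≐refl : ∀ t → Γ ⊢ t ≐ t
  ≐subst : ∀ {s t} (φ : Formula (suc n)) → Γ ⊢ s ≐ t → Γ ⊢ φ [ s ] → Γ ⊢ φ [ t ]

Theory : Set₁
Theory = Formula 0 → Set

_∪_ : Theory → Theory → Theory
(T ∪ S) φ = T φ ⊎ S φ

_⊩_ : Theory → Formula 0 → Set
T ⊩ φ = Σ (List (Formula 0)) λ Γ → All T Γ × (Γ ⊢ φ)

_≡ₜ_ : Theory → Theory → Set
T ≡ₜ S = (∀ φ → T φ → S ⊩ φ) × (∀ φ → S φ → T ⊩ φ)

-- P⁻ (Kaye's PA⁻)

data Pminus : Theory where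
  ax+comm   : Pminus (∀' (∀' (v1 ⊕ v0 ≐ v0 ⊕ v1)))
  ax+assoc  : Pminus (∀' (∀' (∀' ((v2 ⊕ v1) ⊕ v0 ≐ v2 ⊕ (v1 ⊕ v0)))))
  ax*comm   : Pminus (∀' (∀' (v1 ⊗ v0 ≐ v0 ⊗ v1)))
  ax*assoc  : Pminus (∀' (∀' (∀' ((v2 ⊗ v1) ⊗ v0 ≐ v2 ⊗ (v1 ⊗ v0)))))
  axdistr   : Pminus (∀' (∀' (∀' (v2 ⊗ (v1 ⊕ v0) ≐ (v2 ⊗ v1) ⊕ (v2 ⊗ v0)))))
  ax0       : Pminus (∀' ((v0 ⊕ zer ≐ v0) ∧' (v0 ⊗ zer ≐ zer)))
  ax1       : Pminus (∀' (v0 ⊗ one ≐ v0))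
  ax<irr    : Pminus (∀' (¬' (v0 ≺ v0)))
  ax<trans  : Pminus (∀' (∀' (∀' ((v2 ≺ v1) ∧' (v1 ≺ v0) ⇒ v2 ≺ v0))))
  ax<tot    : Pminus (∀' (∀' ((v1 ≺ v0) ∨' (v1 ≐ v0) ∨' (v0 ≺ v1))))
  ax<+      : Pminus (∀' (∀' (∀' (v2 ≺ v1 ⇒ v2 ⊕ v0 ≺ v1 ⊕ v0))))
  ax<*      : Pminus (∀' (∀' (∀' ((zer ≺ v0) ∧' (v2 ≺ v1) ⇒ v2 ⊗ v0 ≺ v1 ⊗ v0))))
  ax-       : Pminus (∀' (∀' (v1 ≺ v0 ⇒ ∃' (v2 ⊕ v0 ≐ v1))))
  ax01      : Pminus ((zer ≺ one) ∧' ∀' (zer ≺ v0 ⇒ (one ≺ v0) ∨' (one ≐ v0)))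
  ax0min    : Pminus (∀' ((zer ≺ v0) ∨' (zer ≐ v0)))

succSub : ∀ {n} → Fin (suc n) → Term (suc n)
succSub zero    = v0 ⊕ one
succSub (suc i) = var (suc i)

Ind : ∀ {n} → Formula (suc n) → Formula n
Ind φ = (φ [ zer ] ∧' ∀' (φ ⇒ subF succSub φ)) ⇒ ∀' φ

data IΣ₁ : Theory where
  base : ∀ {φ} → Pminus φ → IΣ₁ φ
  ind  : ∀ {n} (φ : Formula (suc n)) → SigmaF 1 φ → IΣ₁ (close n (Ind φ))

-- Sequence coding (fixed convention):
--   Cantor pairing  p = ⟨u,w⟩  iff  2p = (u+w)(u+w+1) + 2u;
--   s = ⟨l, ⟨a,b⟩⟩ codes the sequence of length lth(s) = l with
--   entries (s)_i = a mod (1 + (i+1)·b)   (Gödel's β-function).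

Pair : ∀ {m} → Term m → Term m → Term m → Formula m
Pair p u w = ((u ⊕ w) ⊗ ((u ⊕ w) ⊕ one)) ⊕ (u ⊕ u) ≐ p ⊕ p

Rem : ∀ {m} → Term m → Term m → Term m → Formula m
Rem a d r = (r ≺ d) ∧' ∃' (wkT a ≐ (v0 ⊗ wkT d) ⊕ wkT r)

Le : ∀ {m} → Term m → Term m → Formula m
Le x y = (x ≺ y) ∨' (x ≐ y)

wkρ : ∀ {n m} → (Fin n → Term m) → Fin n → Term (suc m)
wkρ ρ i = wkT (ρ i)

inst : ∀ {n m} → Formula (suc (suc n)) → Term m → Term m → (Fin n → Term m) → Formula m
inst {n} {m} φ a b ρ = subF σ φ
  where
  σ : Fin (suc (suc n)) → Term m
  σ zero          = a
  σ (suc zero)    = b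
  σ (suc (suc i)) = ρ i

PFUN : ∀ {n m} → Formula (suc (suc n)) → (Fin n → Term m) → Formula m
PFUN φ ρ = ∀' (∀' (∀' ((inst φ v2 v1 ρ3 ∧' inst φ v2 v0 ρ3) ⇒ v1 ≐ v0)))
  where ρ3 = wkρ (wkρ (wkρ ρ))

ApproxLen : ∀ {n m} → Formula (suc (suc n)) → (Fin n → Term m) → Term m → Term m → Formula m
ApproxLen φ ρ s z =
  ∃' (∃' (∃' (∃' (                      -- l, c, a, b  (b = v0, a = v1, c = v2, l = v3)
    Pair s4 v3 v2 ∧' Pair v2 v1 v0 ∧' (v3 ≐ z4) ∧'
    ∀' (                                -- i = v0, b = v1, a = v2, l = v4
      (v0 ⊕ one ≺ v4) ⇒
      ∀' (∀' (∀' (∀' (                  -- x, y, e, e' : e' = v0, e = v1, y = v2, x = v3,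
                                        --               i = v4, b = v5, a = v6
        (Rem v6 (one ⊕ ((v4 ⊕ one) ⊗ v5)) v1 ∧'
         Rem v6 (one ⊕ ((v4 ⊕ one ⊕ one) ⊗ v5)) v0 ∧'
         Le v3 v1 ∧'
         inst φ v3 v2 ρ9)
        ⇒ Le v2 v0)))))))))
  where
  s4 = wkT (wkT (wkT (wkT s)))
  z4 = wkT (wkT (wkT (wkT z)))
  ρ9 = wkρ (wkρ (wkρ (wkρ (wkρ (wkρ (wkρ (wkρ (wkρ ρ))))))))

Pax : ∀ {n} → Formula (suc (suc n)) → Formula n
Pax φ = PFUN φ var ⇒ ∀' (∃' (ApproxLen φ (wkρ (wkρ var)) v0 v1))

data PΣ₁ : Theory where
  baseI : ∀ {φ} → IΣ₁ φ → PΣ₁ φ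
  pax   : ∀ {n} (φ : Formula (suc (suc n))) → SigmaF 1 φ → PΣ₁ (close n (Pax φ))

{-# OPTIONS --safe #-}
-- Π₃: every axiom of PΣ₁ can be prenexed to Π₃ in pure logic.
--
-- Not Σ₃: PΣ₁ is true in ℕ, so the outer existentials of a Σ₃ axiom have standard witnesses, and
-- finitely many Σ₃ axioms follow from finitely many true Π₂ sentences with standard parameters.
-- Let e code a program checking bounded witnesses for these; Step e w w′ is a Δ₀ relation saying
-- that w′ is least with (w + 1)² < w′ and witnesses below w′ for all arguments below w.  Take the
-- "ultrapower" of ℕ over the set of Step e-chains of length n starting at n (n varying), restricted
-- to functions bounded by the k-th entry of the chain for a standard k.  By Łoś's theorem for Δ₀
-- formulas it satisfies P⁻ and the Π₂ sentences, but the Σ₁ formula "there is a Step e-chain of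
-- length x from n" defines its standard cut, so Σ₁-induction fails.  Forcing with sets of chains
-- replaces the ultrafilter, which keeps the argument constructive.

module Submission where

open import Defs
open import Data.Bool using (Bool; true; T; _∧_)
open import Data.Bool.Properties using (T-∧)
open import Data.Empty using (⊥; ⊥-elim)
open import Data.Fin using (Fin; zero; suc)
open import Data.List using (List; []; _∷_; _++_; length; map)
open import Data.List.Membership.Propositional using (_∈_)
open import Data.List.Membership.Propositional.Properties using (∈-++⁺ˡ; ∈-++⁺ʳ; ∈-++⁻; ∈-map⁺; ∈-map⁻)
open import Data.List.Relation.Unary.All as All using (All; []; _∷_)
open import Data.List.Relation.Unary.All.Properties using (map⁺)
open import Data.List.Relation.Unary.Any using (here; there)
open import Data.Nat
open import Data.Nat.Coprimality as Coprime using (Coprime; coprime-divisor; coprime-Bézout)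
open import Data.Nat.Divisibility
open import Data.Nat.DivMod
open import Data.Nat.GCD using (module Bézout)
open import Data.Nat.Properties
open import Data.Nat.Tactic.RingSolver using (solve-∀)
open import Data.Product using (Σ; ∃-syntax; _×_; _,_; proj₁; proj₂)
open import Data.Sum using (_⊎_; inj₁; inj₂; [_,_]′)
open import Data.Unit using (⊤; tt)
open import Data.Vec as Vec using (Vec; []; _∷_; lookup)
open import Data.Vec.Properties using (lookup-map)
open import Function using (_∘_; Equivalence)
open import Relation.Binary.Definitions using (tri<; tri≈; tri>)
open import Relation.Binary.PropositionalEquality using (_≡_; _≢_; refl; sym; trans; cong; cong₂; subst; subst₂; module ≡-Reasoning)
open import Relation.Nullary using (¬_; Dec; yes; no; contradiction)
open import Relation.Nullary.Decidable using (¬?; decidable-stable; map′; ⌊_⌋; toWitness; fromWitness; _×-dec_; _⊎-dec_; _→-dec_)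

-- The obstacle is a circularity: the model depends on the finitely many axioms used to derive an
-- induction axiom, while those axioms are known only once the induction formula is fixed. The
-- program `e` and the start of the chain are therefore free variables of one fixed formula
-- `chainF`. The closed axiom quantifies over them, the derivation yields the axioms, the axioms
-- yield the program, and only then is the axiom instantiated. A fixed formula must handle every
-- program, which is why evaluation is arithmetized through coded traces. Each ingredient of `Step`
-- has its own task. The square lets sums and products rise by a single level, so the bounded
-- functions form a structure. Leastness makes steps functional, so a coded chain from `n` must run
-- through the entries of the given one. Starting a chain of length `n` at `n` makes this length an
-- element of the lowest level: it exceeds every standard number, and induction breaks there. Truth
-- in ℕ supplies witnesses only under double negation. This is harmless, as the goal is a negation
-- and the conditions are cut only by decidable properties.

private variable
  k m n : ℕ
  φ φ′ ψ ψ′ χ : Formula n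
  Γ Δ : List (Formula n)

-- Prenex normal forms

subT-renT-id : {σ : Fin m → Term n} {ρ : Fin n → Fin m} →
  (∀ i → σ (ρ i) ≡ var i) → ∀ t → subT σ (renT ρ t) ≡ t
subT-renT-id e (var i) = e i
subT-renT-id e zer     = refl
subT-renT-id e one     = refl
subT-renT-id e (s ⊕ t) = cong₂ _⊕_ (subT-renT-id e s) (subT-renT-id e t)
subT-renT-id e (s ⊗ t) = cong₂ _⊗_ (subT-renT-id e s) (subT-renT-id e t)

liftS-liftR-id : {σ : Fin m → Term n} {ρ : Fin n → Fin m} →
  (∀ i → σ (ρ i) ≡ var i) → ∀ i → liftS σ (liftR ρ i) ≡ var i
liftS-liftR-id e zero    = refl
liftS-liftR-id e (suc i) = cong wkT (e i)

subF-renF-id : {σ : Fin m → Term n} {ρ : Fin n → Fin m} →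
  (∀ i → σ (ρ i) ≡ var i) → ∀ φ → subF σ (renF ρ φ) ≡ φ
subF-renF-id e ⊥'       = refl
subF-renF-id e (s ≐ t)  = cong₂ _≐_ (subT-renT-id e s) (subT-renT-id e t)
subF-renF-id e (s ≺ t)  = cong₂ _≺_ (subT-renT-id e s) (subT-renT-id e t)
subF-renF-id e (φ ∧' ψ) = cong₂ _∧'_ (subF-renF-id e φ) (subF-renF-id e ψ)
subF-renF-id e (φ ∨' ψ) = cong₂ _∨'_ (subF-renF-id e φ) (subF-renF-id e ψ)
subF-renF-id e (φ ⇒ ψ)  = cong₂ _⇒_ (subF-renF-id e φ) (subF-renF-id e ψ)
subF-renF-id e (∀' φ)   = cong ∀' (subF-renF-id (liftS-liftR-id e) φ)
subF-renF-id e (∃' φ)   = cong ∃' (subF-renF-id (liftS-liftR-id e) φ)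

wkF-[] : ∀ (φ : Formula n) t → wkF φ [ t ] ≡ φ
wkF-[] φ t = subF-renF-id (λ _ → refl) φ

liftR-suc-[v0] : ∀ (φ : Formula (suc n)) → renF (liftR suc) φ [ v0 ] ≡ φ
liftR-suc-[v0] = subF-renF-id λ { zero → refl ; (suc _) → refl }

renT-subT : {ρ : Fin m → Fin n} {σ : Fin m → Term n} →
  (∀ i → var (ρ i) ≡ σ i) → ∀ t → renT ρ t ≡ subT σ t
renT-subT e (var i) = e i
renT-subT e zer     = refl
renT-subT e one     = refl
renT-subT e (s ⊕ t) = cong₂ _⊕_ (renT-subT e s) (renT-subT e t)
renT-subT e (s ⊗ t) = cong₂ _⊗_ (renT-subT e s) (renT-subT e t)

liftR-liftS : {ρ : Fin m → Fin n} {σ : Fin m → Term n} →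
  (∀ i → var (ρ i) ≡ σ i) → ∀ i → var (liftR ρ i) ≡ liftS σ i
liftR-liftS e zero    = refl
liftR-liftS e (suc i) = cong wkT (e i)

renF-subF : {ρ : Fin m → Fin n} {σ : Fin m → Term n} →
  (∀ i → var (ρ i) ≡ σ i) → ∀ φ → renF ρ φ ≡ subF σ φ
renF-subF e ⊥'       = refl
renF-subF e (s ≐ t)  = cong₂ _≐_ (renT-subT e s) (renT-subT e t)
renF-subF e (s ≺ t)  = cong₂ _≺_ (renT-subT e s) (renT-subT e t)
renF-subF e (φ ∧' ψ) = cong₂ _∧'_ (renF-subF e φ) (renF-subF e ψ)
renF-subF e (φ ∨' ψ) = cong₂ _∨'_ (renF-subF e φ) (renF-subF e ψ)
renF-subF e (φ ⇒ ψ)  = cong₂ _⇒_ (renF-subF e φ) (renF-subF e ψ)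
renF-subF e (∀' φ)   = cong ∀' (renF-subF (liftR-liftS e) φ)
renF-subF e (∃' φ)   = cong ∃' (renF-subF (liftR-liftS e) φ)

subT-wkT : (σ : Fin m → Term n) → ∀ t → subT (liftS σ) (wkT t) ≡ wkT (subT σ t)
subT-wkT σ (var i) = refl
subT-wkT σ zer     = refl
subT-wkT σ one     = refl
subT-wkT σ (s ⊕ t) = cong₂ _⊕_ (subT-wkT σ s) (subT-wkT σ t)
subT-wkT σ (s ⊗ t) = cong₂ _⊗_ (subT-wkT σ s) (subT-wkT σ t)

Δ₀-subF : (σ : Fin m → Term n) → Δ₀ φ → Δ₀ (subF σ φ)
Δ₀-subF σ d⊥        = d⊥
Δ₀-subF σ (d≐ s t)  = d≐ _ _
Δ₀-subF σ (d≺ s t)  = d≺ _ _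
Δ₀-subF σ (d∧ d e)  = d∧ (Δ₀-subF σ d) (Δ₀-subF σ e)
Δ₀-subF σ (d∨ d e)  = d∨ (Δ₀-subF σ d) (Δ₀-subF σ e)
Δ₀-subF σ (d⇒ d e)  = d⇒ (Δ₀-subF σ d) (Δ₀-subF σ e)
Δ₀-subF σ (d∀< t d) = subst (λ u → Δ₀ (∀' (v0 ≺ u ⇒ _))) (sym (subT-wkT σ t))
                        (d∀< (subT σ t) (Δ₀-subF (liftS σ) d))
Δ₀-subF σ (d∃< t d) = subst (λ u → Δ₀ (∃' (v0 ≺ u ∧' _))) (sym (subT-wkT σ t))
                        (d∃< (subT σ t) (Δ₀-subF (liftS σ) d))

mutual
  SigmaF-subF : (σ : Fin m → Term n) → SigmaF k φ → SigmaF k (subF σ φ)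
  SigmaF-subF σ (σ₀ d) = σ₀ (Δ₀-subF σ d)
  SigmaF-subF σ (σΠ p) = σΠ (PiF-subF σ p)
  SigmaF-subF σ (σ∃ s) = σ∃ (SigmaF-subF (liftS σ) s)

  PiF-subF : (σ : Fin m → Term n) → PiF k φ → PiF k (subF σ φ)
  PiF-subF σ (π₀ d) = π₀ (Δ₀-subF σ d)
  PiF-subF σ (πΣ s) = πΣ (SigmaF-subF σ s)
  PiF-subF σ (π∀ p) = π∀ (PiF-subF (liftS σ) p)

SigmaF-wkF : SigmaF k φ → SigmaF k (wkF φ)
SigmaF-wkF {φ = φ} s = subst (SigmaF _) (sym (renF-subF (λ _ → refl) φ)) (SigmaF-subF _ s)

PiF-wkF : PiF k φ → PiF k (wkF φ)
PiF-wkF {φ = φ} p = subst (PiF _) (sym (renF-subF (λ _ → refl) φ)) (PiF-subF _ p)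

-- Derived rules and provable equivalence.

map-⊆ : (f : Formula m → Formula n) → (∀ {φ} → φ ∈ Γ → φ ∈ Δ) → ∀ {φ} → φ ∈ map f Γ → φ ∈ map f Δ
map-⊆ f r i with ∈-map⁻ f i
... | _ , j , refl = ∈-map⁺ f (r j)

∷-⊆ : (∀ {φ} → φ ∈ Γ → φ ∈ Δ) → ∀ {φ} → φ ∈ (ψ ∷ Γ) → φ ∈ (ψ ∷ Δ)
∷-⊆ r (here e)  = here e
∷-⊆ r (there i) = there (r i)

weaken : (∀ {φ} → φ ∈ Γ → φ ∈ Δ) → Γ ⊢ φ → Δ ⊢ φ
weaken r (hyp i)        = hyp (r i)
weaken r (⊥E d)         = ⊥E (weaken r d)
weaken r (raa d)        = raa (weaken (∷-⊆ r) d)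
weaken r (⇒I d)         = ⇒I (weaken (∷-⊆ r) d)
weaken r (⇒E d e)       = ⇒E (weaken r d) (weaken r e)
weaken r (∧I d e)       = ∧I (weaken r d) (weaken r e)
weaken r (∧E₁ d)        = ∧E₁ (weaken r d)
weaken r (∧E₂ d)        = ∧E₂ (weaken r d)
weaken r (∨I₁ d)        = ∨I₁ (weaken r d)
weaken r (∨I₂ d)        = ∨I₂ (weaken r d)
weaken r (∨E d e f)     = ∨E (weaken r d) (weaken (∷-⊆ r) e) (weaken (∷-⊆ r) f)
weaken r (∀I d)         = ∀I (weaken (map-⊆ wkF r) d)
weaken r (∀E d t)       = ∀E (weaken r d) t
weaken r (∃I t d)       = ∃I t (weaken r d)
weaken r (∃E d e)       = ∃E (weaken r d) (weaken (∷-⊆ (map-⊆ wkF r)) e)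
weaken r (≐refl t)      = ≐refl t
weaken r (≐subst φ d e) = ≐subst φ (weaken r d) (weaken r e)

cut : Γ ⊢ φ → (φ ∷ []) ⊢ ψ → Γ ⊢ ψ
cut d e = ⇒E (weaken (λ ()) (⇒I e)) d

h0 : (φ ∷ Γ) ⊢ φ
h0 = hyp (here refl)

h1 : (ψ ∷ φ ∷ Γ) ⊢ φ
h1 = hyp (there (here refl))

h2 : (χ ∷ ψ ∷ φ ∷ Γ) ⊢ φ
h2 = hyp (there (there (here refl)))

∀E-v0 : Γ ⊢ wkF (∀' φ) → Γ ⊢ φ
∀E-v0 {φ = φ} d = subst (_ ⊢_) (liftR-suc-[v0] φ) (∀E d v0)

∃I-v0 : Γ ⊢ φ → Γ ⊢ wkF (∃' φ)
∃I-v0 {φ = φ} d = ∃I v0 (subst (_ ⊢_) (sym (liftR-suc-[v0] φ)) d)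

wkF-[]-elim : ∀ t → Γ ⊢ wkF φ [ t ] → Γ ⊢ φ
wkF-[]-elim {φ = φ} t = subst (_ ⊢_) (wkF-[] φ t)

infix 0 _≃_

_≃_ : Formula n → Formula n → Set
φ ≃ ψ = ((φ ∷ []) ⊢ ψ) × ((ψ ∷ []) ⊢ φ)

≃-refl : φ ≃ φ
≃-refl = h0 , h0

≃-trans : φ ≃ ψ → ψ ≃ χ → φ ≃ χ
≃-trans e f = cut (proj₁ e) (proj₁ f) , cut (proj₂ f) (proj₂ e)

¬-cong : φ ≃ ψ → ¬' φ ≃ ¬' ψ
¬-cong e = ⇒I (⇒E h1 (cut h0 (proj₂ e))) , ⇒I (⇒E h1 (cut h0 (proj₁ e)))

∀-cong : φ ≃ ψ → ∀' φ ≃ ∀' ψ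
∀-cong e = ∀I (cut (∀E-v0 h0) (proj₁ e)) , ∀I (cut (∀E-v0 h0) (proj₂ e))

∃-cong : φ ≃ ψ → ∃' φ ≃ ∃' ψ
∃-cong e = ∃E h0 (∃I-v0 (cut h0 (proj₁ e))) , ∃E h0 (∃I-v0 (cut h0 (proj₂ e)))

¬∃≃∀¬ : ¬' (∃' φ) ≃ ∀' (¬' φ)
¬∃≃∀¬ = ∀I (⇒I (⇒E h1 (∃I-v0 h0))) , ⇒I (∃E h0 (⇒E (∀E-v0 h2) h0))

¬∀≃∃¬ : ¬' (∀' φ) ≃ ∃' (¬' φ)
¬∀≃∃¬ = raa (⇒E h1 (∀I (raa (⇒E h1 (∃I-v0 h0))))) , ⇒I (∃E h1 (⇒E h0 (∀E-v0 h1)))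

data Op : Set where
  and or : Op

op : Op → Formula n → Formula n → Formula n
op and = _∧'_
op or  = _∨'_

dual : Op → Op
dual and = or
dual or  = and

op-cong : ∀ o → φ ≃ φ′ → ψ ≃ ψ′ → op o φ ψ ≃ op o φ′ ψ′
op-cong and e f = ∧I (cut (∧E₁ h0) (proj₁ e)) (cut (∧E₂ h0) (proj₁ f))
                , ∧I (cut (∧E₁ h0) (proj₂ e)) (cut (∧E₂ h0) (proj₂ f))
op-cong or  e f = ∨E h0 (∨I₁ (cut h0 (proj₁ e))) (∨I₂ (cut h0 (proj₁ f)))
                , ∨E h0 (∨I₁ (cut h0 (proj₂ e))) (∨I₂ (cut h0 (proj₂ f)))

op-comm : ∀ o → op o φ ψ ≃ op o ψ φ
op-comm and = ∧I (∧E₂ h0) (∧E₁ h0) , ∧I (∧E₂ h0) (∧E₁ h0)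
op-comm or  = ∨E h0 (∨I₂ h0) (∨I₁ h0) , ∨E h0 (∨I₂ h0) (∨I₁ h0)

op-∀ : ∀ o → op o (∀' φ) ψ ≃ ∀' (op o φ (wkF ψ))
op-∀ and = ∀I (∧I (∀E-v0 (∧E₁ h0)) (∧E₂ h0))
         -- Any term serves here: `ψ` does not contain the quantified variable, and `zer` witnesses
         -- that the domain is nonempty.
         , ∧I (∀I (∧E₁ (∀E-v0 h0))) (wkF-[]-elim zer (∧E₂ (∀E h0 zer)))
op-∀ or  = ∀I (∨E h0 (∨I₁ (∀E-v0 h0)) (∨I₂ h0))
         , raa (⇒E h0 (∨I₁ (∀I (∨E (∀E-v0 h1) h0 (⊥E (⇒E h1 (∨I₂ h0)))))))

deMorgan : ∀ o → op o φ ψ ≃ ¬' (op (dual o) (¬' φ) (¬' ψ))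
deMorgan and = ⇒I (∨E h0 (⇒E h0 (∧E₁ h2)) (⇒E h0 (∧E₂ h2)))
             , ∧I (raa (⇒E h1 (∨I₁ h0))) (raa (⇒E h1 (∨I₂ h0)))
deMorgan or  = ⇒I (∨E h1 (⇒E (∧E₁ h1) h0) (⇒E (∧E₂ h1) h0))
             , raa (⇒E h1 (∧I (⇒I (⇒E h1 (∨I₁ h0))) (⇒I (⇒E h1 (∨I₂ h0)))))

⇒≃¬∨ : (φ ⇒ ψ) ≃ (¬' φ ∨' ψ)
⇒≃¬∨ = raa (⇒E h0 (∨I₁ (⇒I (⇒E h1 (∨I₂ (⇒E h2 h0)))))) , ⇒I (∨E h1 (⊥E (⇒E h0 h1)) h0)

-- Prenex classes up to equivalence in pure logic.

ΠLike ΣLike : ℕ → Formula n → Set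
ΠLike k φ = Σ (Formula _) λ ψ → PiF k ψ × (φ ≃ ψ)
ΣLike k φ = Σ (Formula _) λ ψ → SigmaF k ψ × (φ ≃ ψ)

ΠLike-resp : φ ≃ ψ → ΠLike k ψ → ΠLike k φ
ΠLike-resp e (χ , p , f) = χ , p , ≃-trans e f

ΣLike-resp : φ ≃ ψ → ΣLike k ψ → ΣLike k φ
ΣLike-resp e (χ , p , f) = χ , p , ≃-trans e f

Δ⇒Π : Δ₀ φ → ΠLike 0 φ
Δ⇒Π d = _ , π₀ d , ≃-refl

Δ⇒Σ : Δ₀ φ → ΣLike 0 φ
Δ⇒Σ d = _ , σ₀ d , ≃-refl

Σ⇒Π : ΣLike k φ → ΠLike (suc k) φ
Σ⇒Π (ψ , s , e) = ψ , πΣ s , e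

Π⇒Σ : ΠLike k φ → ΣLike (suc k) φ
Π⇒Σ (ψ , p , e) = ψ , σΠ p , e

mutual
  SigmaF-suc : SigmaF k φ → SigmaF (suc k) φ
  SigmaF-suc (σ₀ d) = σΠ (π₀ d)
  SigmaF-suc (σΠ p) = σΠ (PiF-suc p)
  SigmaF-suc (σ∃ s) = σ∃ (SigmaF-suc s)

  PiF-suc : PiF k φ → PiF (suc k) φ
  PiF-suc (π₀ d) = πΣ (σ₀ d)
  PiF-suc (πΣ s) = πΣ (SigmaF-suc s)
  PiF-suc (π∀ p) = π∀ (PiF-suc p)

Π-suc : ΠLike k φ → ΠLike (suc k) φ
Π-suc (ψ , p , e) = ψ , PiF-suc p , e

Σ-suc : ΣLike k φ → ΣLike (suc k) φ
Σ-suc (ψ , s , e) = ψ , SigmaF-suc s , e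

Π-∀ : ΠLike (suc k) φ → ΠLike (suc k) (∀' φ)
Π-∀ (ψ , p , e) = ∀' ψ , π∀ p , ∀-cong e

Σ-∃ : ΣLike (suc k) φ → ΣLike (suc k) (∃' φ)
Σ-∃ (ψ , s , e) = ∃' ψ , σ∃ s , ∃-cong e

mutual
  SigmaF-¬ : SigmaF k φ → ΠLike k (¬' φ)
  SigmaF-¬ (σ₀ d) = Δ⇒Π (d⇒ d d⊥)
  SigmaF-¬ (σΠ p) = Σ⇒Π (PiF-¬ p)
  SigmaF-¬ (σ∃ s) = ΠLike-resp ¬∃≃∀¬ (Π-∀ (SigmaF-¬ s))

  PiF-¬ : PiF k φ → ΣLike k (¬' φ)
  PiF-¬ (π₀ d) = Δ⇒Σ (d⇒ d d⊥)
  PiF-¬ (πΣ s) = Π⇒Σ (SigmaF-¬ s)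
  PiF-¬ (π∀ p) = ΣLike-resp ¬∀≃∃¬ (Σ-∃ (PiF-¬ p))

Π-¬ : ΣLike k φ → ΠLike k (¬' φ)
Π-¬ (ψ , s , e) = ΠLike-resp (¬-cong e) (SigmaF-¬ s)

Σ-¬ : ΠLike k φ → ΣLike k (¬' φ)
Σ-¬ (ψ , p , e) = ΣLike-resp (¬-cong e) (PiF-¬ p)

mutual
  -- The explicit `k` is the termination measure. At level `suc k` the universal prefixes of the two
  -- sides are stripped in turn; the Σ formulas left over are negated by De Morgan and return to
  -- `PiF-op` at level `k`, although their negated derivations are not subterms of anything. Only ∀
  -- thus needs a rule for pulling it out.
  PiF-op : ∀ o k → {φ ψ : Formula n} → PiF k φ → PiF k ψ → ΠLike k (op o φ ψ)
  PiF-op and zero    (π₀ d) (π₀ e) = Δ⇒Π (d∧ d e)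
  PiF-op or  zero    (π₀ d) (π₀ e) = Δ⇒Π (d∨ d e)
  PiF-op o   (suc k) (π∀ p) q      = ΠLike-resp (op-∀ o) (Π-∀ (PiF-op o (suc k) p (PiF-wkF q)))
  PiF-op o   (suc k) (πΣ s) q      = SigmaF-PiF-op o k s q

  SigmaF-PiF-op : ∀ o k → {φ ψ : Formula n} → SigmaF k φ → PiF (suc k) ψ → ΠLike (suc k) (op o φ ψ)
  SigmaF-PiF-op o k s (πΣ s′) = Σ⇒Π (SigmaF-op o k s s′)
  SigmaF-PiF-op o k s (π∀ p)  =
    ΠLike-resp (≃-trans (op-comm o) (≃-trans (op-∀ o) (∀-cong (op-comm o))))
      (Π-∀ (SigmaF-PiF-op o k (SigmaF-wkF s) p))

  SigmaF-op : ∀ o k → {φ ψ : Formula n} → SigmaF k φ → SigmaF k ψ → ΣLike k (op o φ ψ)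
  SigmaF-op o k s s′ =
    let _ , p , e = SigmaF-¬ s
        _ , q , f = SigmaF-¬ s′
    in ΣLike-resp (≃-trans (deMorgan o) (¬-cong (op-cong (dual o) e f))) (Σ-¬ (PiF-op (dual o) k p q))

Π-op : ∀ o → ΠLike k φ → ΠLike k ψ → ΠLike k (op o φ ψ)
Π-op o (_ , p , e) (_ , q , f) = ΠLike-resp (op-cong o e f) (PiF-op o _ p q)

Σ-op : ∀ o → ΣLike k φ → ΣLike k ψ → ΣLike k (op o φ ψ)
Σ-op o (_ , p , e) (_ , q , f) = ΣLike-resp (op-cong o e f) (SigmaF-op o _ p q)

Π-⇒ : ΣLike k φ → ΠLike k ψ → ΠLike k (φ ⇒ ψ)
Π-⇒ s p = ΠLike-resp ⇒≃¬∨ (Π-op or (Π-¬ s) p)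

Π-close : ∀ n {φ : Formula n} → ΠLike (suc k) φ → ΠLike (suc k) (close n φ)
Π-close zero    p = p
Π-close (suc n) p = Π-close n (Π-∀ p)

-- The inductive step is a universally quantified implication between Σ₁ formulas, hence Π₂; as a
-- premise it counts as Σ₃. This premise, not the Π₂ conclusion, is what costs the third quantifier
-- block.
Π3-Ind : (φ : Formula (suc n)) → SigmaF 1 φ → ΠLike 3 (Ind φ)
Π3-Ind φ s = Π-⇒ (Σ-op and (Σ-suc (Σ-suc (_ , SigmaF-subF _ s , ≃-refl)))
                  (Π⇒Σ (Π-∀ (Π-⇒ (Σ-suc (_ , s , ≃-refl)) (Σ⇒Π (_ , SigmaF-subF _ s , ≃-refl))))))
              (Π-∀ (Π-suc (Σ⇒Π (_ , s , ≃-refl))))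

Σ1-Rem : ∀ (a d r : Term n) → ΣLike 1 (Rem a d r)
Σ1-Rem a d r = Σ-op and (Σ-suc (Δ⇒Σ (d≺ _ _))) (Σ-∃ (Σ-suc (Δ⇒Σ (d≐ _ _))))

Δ₀-Le : ∀ (s t : Term n) → Δ₀ (Le s t)
Δ₀-Le s t = d∨ (d≺ _ _) (d≐ _ _)

-- In both `PFUN` and the approximation condition the Σ₁ parts (`φ` and the unbounded quotients of
-- `Rem`) stand only in premises, so both are Π₁. Quantifying the code makes the existence of an
-- approximation Σ₂, and the length in front makes it Π₃.
Π3-Pax : (φ : Formula (suc (suc n))) → SigmaF 1 φ → ΠLike 3 (Pax φ)
Π3-Pax φ s =
  Π-⇒ (Σ-suc (Π⇒Σ pfun)) (Π-∀ (Σ⇒Π (Σ-∃ approx)))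
  where
  inst-Σ : ∀ {m} (a b : Term m) ρ → ΣLike 1 (inst φ a b ρ)
  inst-Σ a b ρ = _ , SigmaF-subF _ s , ≃-refl
  pfun : ΠLike 1 (PFUN φ var)
  pfun = Π-∀ (Π-∀ (Π-∀ (Π-⇒ (Σ-op and (inst-Σ _ _ _) (inst-Σ _ _ _)) (Π-suc (Δ⇒Π (d≐ _ _))))))
  Δ-2 : ∀ {m} {φ : Formula m} → Δ₀ φ → ΣLike 2 φ
  Δ-2 d = Σ-suc (Σ-suc (Δ⇒Σ d))
  approx : ∀ {m} {ρ : Fin _ → Term m} {s z : Term m} → ΣLike 2 (ApproxLen φ ρ s z)
  approx = Σ-∃ (Σ-∃ (Σ-∃ (Σ-∃ (Σ-op and (Δ-2 (d≐ _ _)) (Σ-op and (Δ-2 (d≐ _ _)) (Σ-op and (Δ-2 (d≐ _ _))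
    (Π⇒Σ (Π-∀ (Π-⇒ (Σ-suc (Δ⇒Σ (d≺ _ _))) (Π-∀ (Π-∀ (Π-∀ (Π-∀ (Π-⇒
      (Σ-op and (Σ1-Rem _ _ _) (Σ-op and (Σ1-Rem _ _ _) (Σ-op and (Σ-suc (Δ⇒Σ (Δ₀-Le _ _))) (inst-Σ _ _ _))))
      (Π-suc (Δ⇒Π (Δ₀-Le _ _)))))))))))))))))

Π1⇒Π3 : ΠLike 1 φ → ΠLike 3 φ
Π1⇒Π3 p = Π-suc (Π-suc p)

Δ⇒Π1 : Δ₀ φ → ΠLike 1 φ
Δ⇒Π1 d = Π-suc (Δ⇒Π d)

Π3-Pminus : Pminus φ → ΠLike 3 φ
Π3-Pminus ax+comm  = Π1⇒Π3 (Π-∀ (Π-∀ (Δ⇒Π1 (d≐ _ _))))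
Π3-Pminus ax+assoc = Π1⇒Π3 (Π-∀ (Π-∀ (Π-∀ (Δ⇒Π1 (d≐ _ _)))))
Π3-Pminus ax*comm  = Π1⇒Π3 (Π-∀ (Π-∀ (Δ⇒Π1 (d≐ _ _))))
Π3-Pminus ax*assoc = Π1⇒Π3 (Π-∀ (Π-∀ (Π-∀ (Δ⇒Π1 (d≐ _ _)))))
Π3-Pminus axdistr  = Π1⇒Π3 (Π-∀ (Π-∀ (Π-∀ (Δ⇒Π1 (d≐ _ _)))))
Π3-Pminus ax0      = Π1⇒Π3 (Π-∀ (Δ⇒Π1 (d∧ (d≐ _ _) (d≐ _ _))))
Π3-Pminus ax1      = Π1⇒Π3 (Π-∀ (Δ⇒Π1 (d≐ _ _)))
Π3-Pminus ax<irr   = Π1⇒Π3 (Π-∀ (Δ⇒Π1 (d⇒ (d≺ _ _) d⊥)))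
Π3-Pminus ax<trans = Π1⇒Π3 (Π-∀ (Π-∀ (Π-∀ (Δ⇒Π1 (d⇒ (d∧ (d≺ _ _) (d≺ _ _)) (d≺ _ _))))))
Π3-Pminus ax<tot   = Π1⇒Π3 (Π-∀ (Π-∀ (Δ⇒Π1 (d∨ (d≺ _ _) (d∨ (d≐ _ _) (d≺ _ _))))))
Π3-Pminus ax<+     = Π1⇒Π3 (Π-∀ (Π-∀ (Π-∀ (Δ⇒Π1 (d⇒ (d≺ _ _) (d≺ _ _))))))
Π3-Pminus ax<*     = Π1⇒Π3 (Π-∀ (Π-∀ (Π-∀ (Δ⇒Π1 (d⇒ (d∧ (d≺ _ _) (d≺ _ _)) (d≺ _ _))))))
Π3-Pminus ax-      = Π-suc (Π-∀ (Π-∀ (Π-⇒ (Σ-suc (Σ-suc (Δ⇒Σ (d≺ _ _))))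
                       (Σ⇒Π (Σ-∃ (Σ-suc (Δ⇒Σ (d≐ _ _))))))))
Π3-Pminus ax01     = Π1⇒Π3 (Π-op and (Δ⇒Π1 (d≺ _ _))
                       (Π-∀ (Δ⇒Π1 (d⇒ (d≺ _ _) (d∨ (d≺ _ _) (d≐ _ _))))))
Π3-Pminus ax0min   = Π1⇒Π3 (Π-∀ (Δ⇒Π1 (d∨ (d≺ _ _) (d≐ _ _))))

Π3-PΣ₁ : PΣ₁ φ → ΠLike 3 φ
Π3-PΣ₁ (baseI (base a))         = Π3-Pminus a
Π3-PΣ₁ (baseI (ind {n} φ s))    = Π-close n (Π3-Ind φ s)
Π3-PΣ₁ (pax {n} φ s)            = Π-close n (Π3-Pax φ s)

-- All Π₃ theorems are taken as axioms. Each axiom of `PΣ₁` then follows from its own prenex form,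
-- which is among these theorems.
Π3-axiomatization : Σ Theory (λ A → (∀ φ → A φ → PiF 3 φ) × (A ≡ₜ PΣ₁))
Π3-axiomatization = A , (λ _ → proj₁) , (λ _ → proj₂) , λ φ a →
  let ψ , p , e = Π3-PΣ₁ a
  in ψ ∷ [] , (p , φ ∷ [] , a ∷ [] , proj₁ e) ∷ [] , proj₂ e
  where
  A : Theory
  A φ = PiF 3 φ × (PΣ₁ ⊩ φ)

-- Forcing semantics

-- Weak (classical) forcing: a condition that is Bad forces everything, and
-- disjunctions and existentials are read through double negation.
record Frame : Set₁ where
  infix 4 _⊑_
  infixl 6 _+D_
  infixl 7 _*D_
  field
    Cond     : Set
    _⊑_      : Cond → Cond → Set
    ⊑-refl   : ∀ {p} → p ⊑ p
    ⊑-trans  : ∀ {p q r} → r ⊑ q → q ⊑ p → r ⊑ p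
    Bad      : Cond → Set
    Bad-mono : ∀ {p q} → q ⊑ p → Bad p → Bad q
    D        : Set
    0D 1D    : D
    _+D_ _*D_ : D → D → D
    Eq Lt    : Cond → D → D → Set
    Eq-mono  : ∀ {p q a b} → q ⊑ p → Eq p a b → Eq q a b
    Lt-mono  : ∀ {p q a b} → q ⊑ p → Lt p a b → Lt q a b

  -- Forced double negation elimination, with `Bad` as falsity: the soundness of `raa`.
  Stable : (Cond → Set) → Set
  Stable P = ∀ {p} → (∀ {q} → q ⊑ p → (∀ {r} → r ⊑ q → P r → Bad r) → Bad q) → P p

  field
    Eq-stable : ∀ {a b} → Stable (λ p → Eq p a b)
    Lt-stable : ∀ {a b} → Stable (λ p → Lt p a b)
    Eq-refl   : ∀ {p a} → Eq p a a
    Eq-sym    : ∀ {p a b} → Eq p a b → Eq p b a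
    Eq-trans  : ∀ {p a b c} → Eq p a b → Eq p b c → Eq p a c
    Eq-+      : ∀ {p a b c d} → Eq p a b → Eq p c d → Eq p (a +D c) (b +D d)
    Eq-*      : ∀ {p a b c d} → Eq p a b → Eq p c d → Eq p (a *D c) (b *D d)
    Lt-resp   : ∀ {p a b c d} → Eq p a b → Eq p c d → Lt p a c → Lt p b d

  private variable
    p q : Cond

  ev : Term n → Vec D n → D
  ev (var i) ρ = lookup ρ i
  ev zer     ρ = 0D
  ev one     ρ = 1D
  ev (s ⊕ t) ρ = ev s ρ +D ev t ρ
  ev (s ⊗ t) ρ = ev s ρ *D ev t ρ

  Forces : Cond → Formula n → Vec D n → Set
  Forces p ⊥'       ρ = Bad p
  Forces p (s ≐ t)  ρ = Eq p (ev s ρ) (ev t ρ)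
  Forces p (s ≺ t)  ρ = Lt p (ev s ρ) (ev t ρ)
  Forces p (φ ∧' ψ) ρ = Forces p φ ρ × Forces p ψ ρ
  Forces p (φ ∨' ψ) ρ = ∀ {q} → q ⊑ p → (∀ {r} → r ⊑ q → Forces r φ ρ → Bad r) →
                          (∀ {r} → r ⊑ q → Forces r ψ ρ → Bad r) → Bad q
  Forces p (φ ⇒ ψ)  ρ = ∀ {q} → q ⊑ p → Forces q φ ρ → Forces q ψ ρ
  Forces p (∀' φ)   ρ = ∀ d → Forces p φ (d ∷ ρ)
  Forces p (∃' φ)   ρ = ∀ {q} → q ⊑ p → (∀ d {r} → r ⊑ q → Forces r φ (d ∷ ρ) → Bad r) → Bad q

  Forces-mono : ∀ (φ : Formula n) {ρ} → q ⊑ p → Forces p φ ρ → Forces q φ ρ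
  Forces-mono ⊥'       l x       = Bad-mono l x
  Forces-mono (s ≐ t)  l x       = Eq-mono l x
  Forces-mono (s ≺ t)  l x       = Lt-mono l x
  Forces-mono (φ ∧' ψ) l (x , y) = Forces-mono φ l x , Forces-mono ψ l y
  Forces-mono (φ ∨' ψ) l x       = λ l′ → x (⊑-trans l′ l)
  Forces-mono (φ ⇒ ψ)  l x       = λ l′ → x (⊑-trans l′ l)
  Forces-mono (∀' φ)   l x       = λ d → Forces-mono φ l (x d)
  Forces-mono (∃' φ)   l x       = λ l′ → x (⊑-trans l′ l)

  Forces-stable : ∀ (φ : Formula n) {ρ} → Stable (λ p → Forces p φ ρ)
  Forces-stable ⊥'       h = h ⊑-refl (λ _ b → b)
  Forces-stable (s ≐ t)  h = Eq-stable h
  Forces-stable (s ≺ t)  h = Lt-stable h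
  Forces-stable (φ ∧' ψ) h = Forces-stable φ (λ l k → h l (λ l′ → k l′ ∘ proj₁))
                           , Forces-stable ψ (λ l k → h l (λ l′ → k l′ ∘ proj₂))
  Forces-stable (φ ∨' ψ) h l k₁ k₂ =
    h l (λ l′ f → f ⊑-refl (λ l″ → k₁ (⊑-trans l″ l′)) (λ l″ → k₂ (⊑-trans l″ l′)))
  Forces-stable (φ ⇒ ψ)  h l x = Forces-stable ψ λ l′ k →
    h (⊑-trans l′ l) (λ l″ f → k l″ (f ⊑-refl (Forces-mono φ (⊑-trans l″ l′) x)))
  Forces-stable (∀' φ)   h d = Forces-stable φ (λ l k → h l (λ l′ f → k l′ (f d)))
  Forces-stable (∃' φ)   h l k = h l (λ l′ f → f ⊑-refl (λ d l″ → k d (⊑-trans l″ l′)))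

  Forces-Bad : ∀ (φ : Formula n) {ρ} → Bad p → Forces p φ ρ
  Forces-Bad φ b = Forces-stable φ (λ l _ → Bad-mono l b)

  Forces-∃I : ∀ {φ : Formula (suc n)} {ρ} d → Forces p φ (d ∷ ρ) → Forces p (∃' φ) ρ
  Forces-∃I {φ = φ} d x l k = k d ⊑-refl (Forces-mono φ l x)

  -- A forced existential yields no witness, so it can be eliminated only into a stable conclusion,
  -- here the forcing of another formula.
  Forces-∃E : ∀ {φ : Formula (suc n)} (χ : Formula m) {ρ ρ′} → Forces p (∃' φ) ρ →
    (∀ d {q} → q ⊑ p → Forces q φ (d ∷ ρ) → Forces q χ ρ′) → Forces p χ ρ′
  Forces-∃E χ f g = Forces-stable χ λ l k →
    f l (λ d l′ x → k l′ (g d (⊑-trans l′ l) x))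

  ev-subT : ∀ {σ : Fin m → Term n} {ρ ρ′} → (∀ i → ev (σ i) ρ ≡ lookup ρ′ i) →
    ∀ t → ev (subT σ t) ρ ≡ ev t ρ′
  ev-subT e (var i) = e i
  ev-subT e zer     = refl
  ev-subT e one     = refl
  ev-subT e (s ⊕ t) = cong₂ _+D_ (ev-subT e s) (ev-subT e t)
  ev-subT e (s ⊗ t) = cong₂ _*D_ (ev-subT e s) (ev-subT e t)

  ev-wkT : ∀ (t : Term n) {d ρ} → ev (wkT t) (d ∷ ρ) ≡ ev t ρ
  ev-wkT (var i) = refl
  ev-wkT zer     = refl
  ev-wkT one     = refl
  ev-wkT (s ⊕ t) = cong₂ _+D_ (ev-wkT s) (ev-wkT t)
  ev-wkT (s ⊗ t) = cong₂ _*D_ (ev-wkT s) (ev-wkT t)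

  ev-liftS : ∀ {σ : Fin m → Term n} {ρ ρ′ d} → (∀ i → ev (σ i) ρ ≡ lookup ρ′ i) →
    ∀ i → ev (liftS σ i) (d ∷ ρ) ≡ lookup (d ∷ ρ′) i
  ev-liftS         e zero    = refl
  ev-liftS {σ = σ} e (suc i) = trans (ev-wkT (σ i)) (e i)

  mutual
    Forces-subF : ∀ {σ : Fin m → Term n} {ρ ρ′} → (∀ i → ev (σ i) ρ ≡ lookup ρ′ i) →
      ∀ φ → Forces p (subF σ φ) ρ → Forces p φ ρ′
    Forces-subF e ⊥'       x       = x
    Forces-subF e (s ≐ t)  x       = subst₂ (Eq _) (ev-subT e s) (ev-subT e t) x
    Forces-subF e (s ≺ t)  x       = subst₂ (Lt _) (ev-subT e s) (ev-subT e t) x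
    Forces-subF e (φ ∧' ψ) (x , y) = Forces-subF e φ x , Forces-subF e ψ y
    Forces-subF e (φ ∨' ψ) x l f g =
      x l (λ l′ → f l′ ∘ Forces-subF e φ) (λ l′ → g l′ ∘ Forces-subF e ψ)
    Forces-subF e (φ ⇒ ψ)  x l     = Forces-subF e ψ ∘ x l ∘ Forces-subF⁻ e φ
    Forces-subF e (∀' φ)   x d     = Forces-subF (ev-liftS e) φ (x d)
    Forces-subF e (∃' φ)   x l f   = x l (λ d l′ → f d l′ ∘ Forces-subF (ev-liftS e) φ)

    Forces-subF⁻ : ∀ {σ : Fin m → Term n} {ρ ρ′} → (∀ i → ev (σ i) ρ ≡ lookup ρ′ i) →
      ∀ φ → Forces p φ ρ′ → Forces p (subF σ φ) ρ
    Forces-subF⁻ e ⊥'       x       = x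
    Forces-subF⁻ e (s ≐ t)  x       = subst₂ (Eq _) (sym (ev-subT e s)) (sym (ev-subT e t)) x
    Forces-subF⁻ e (s ≺ t)  x       = subst₂ (Lt _) (sym (ev-subT e s)) (sym (ev-subT e t)) x
    Forces-subF⁻ e (φ ∧' ψ) (x , y) = Forces-subF⁻ e φ x , Forces-subF⁻ e ψ y
    Forces-subF⁻ e (φ ∨' ψ) x l f g =
      x l (λ l′ → f l′ ∘ Forces-subF⁻ e φ) (λ l′ → g l′ ∘ Forces-subF⁻ e ψ)
    Forces-subF⁻ e (φ ⇒ ψ)  x l     = Forces-subF⁻ e ψ ∘ x l ∘ Forces-subF e φ
    Forces-subF⁻ e (∀' φ)   x d     = Forces-subF⁻ (ev-liftS e) φ (x d)
    Forces-subF⁻ e (∃' φ)   x l f   = x l (λ d l′ → f d l′ ∘ Forces-subF⁻ (ev-liftS e) φ)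

  ev-▸ : ∀ (t : Term n) {ρ} i → ev ((t ▸ var) i) ρ ≡ lookup (ev t ρ ∷ ρ) i
  ev-▸ t zero    = refl
  ev-▸ t (suc i) = refl

  Forces-[] : ∀ (φ : Formula (suc n)) t {ρ} → Forces p (φ [ t ]) ρ → Forces p φ (ev t ρ ∷ ρ)
  Forces-[] φ t = Forces-subF (ev-▸ t) φ

  Forces-[]⁻ : ∀ (φ : Formula (suc n)) t {ρ} → Forces p φ (ev t ρ ∷ ρ) → Forces p (φ [ t ]) ρ
  Forces-[]⁻ φ t = Forces-subF⁻ (ev-▸ t) φ

  Forces-wkF : ∀ (φ : Formula n) {ρ d} → Forces p (wkF φ) (d ∷ ρ) → Forces p φ ρ
  Forces-wkF {p = p} φ {ρ} {d} = Forces-subF (λ _ → refl) φ ∘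
    subst (λ ψ → Forces p ψ (d ∷ ρ)) (renF-subF (λ _ → refl) φ)

  Forces-wkF⁻ : ∀ (φ : Formula n) {ρ d} → Forces p φ ρ → Forces p (wkF φ) (d ∷ ρ)
  Forces-wkF⁻ {p = p} φ {ρ} {d} = 
    subst (λ ψ → Forces p ψ (d ∷ ρ)) (sym (renF-subF (λ _ → refl) φ)) ∘ Forces-subF⁻ (λ _ → refl) φ

  ev-resp : ∀ {ρ ρ′} → (∀ i → Eq p (lookup ρ i) (lookup ρ′ i)) → ∀ (t : Term n) → Eq p (ev t ρ) (ev t ρ′)
  ev-resp e (var i) = e i
  ev-resp e zer     = Eq-refl
  ev-resp e one     = Eq-refl
  ev-resp e (s ⊕ t) = Eq-+ (ev-resp e s) (ev-resp e t)
  ev-resp e (s ⊗ t) = Eq-* (ev-resp e s) (ev-resp e t)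

  Forces-resp : ∀ {ρ ρ′} → (∀ i → Eq p (lookup ρ i) (lookup ρ′ i)) → ∀ (φ : Formula n) →
    Forces p φ ρ → Forces p φ ρ′
  Forces-resp e ⊥'       x       = x
  Forces-resp e (s ≐ t)  x       = Eq-trans (Eq-sym (ev-resp e s)) (Eq-trans x (ev-resp e t))
  Forces-resp e (s ≺ t)  x       = Lt-resp (ev-resp e s) (ev-resp e t) x
  Forces-resp e (φ ∧' ψ) (x , y) = Forces-resp e φ x , Forces-resp e ψ y
  Forces-resp e (φ ∨' ψ) x l f g =
    x l (λ l′ → f l′ ∘ Forces-resp (Eq-mono (⊑-trans l′ l) ∘ e) φ)
        (λ l′ → g l′ ∘ Forces-resp (Eq-mono (⊑-trans l′ l) ∘ e) ψ)
  Forces-resp e (φ ⇒ ψ)  x l     =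
    Forces-resp (Eq-mono l ∘ e) ψ ∘ x l ∘ Forces-resp (Eq-sym ∘ Eq-mono l ∘ e) φ
  Forces-resp e (∀' φ)   x d     = Forces-resp (λ { zero → Eq-refl ; (suc i) → e i }) φ (x d)
  Forces-resp e (∃' φ)   x l f   = x l λ d l′ → f d l′ ∘
    Forces-resp (λ { zero → Eq-refl ; (suc i) → Eq-mono (⊑-trans l′ l) (e i) }) φ

  sound : ∀ {Γ : List (Formula n)} {φ ρ} → Γ ⊢ φ → All (λ ψ → Forces p ψ ρ) Γ → Forces p φ ρ
  sounds-mono : ∀ {Γ : List (Formula n)} {ρ} → q ⊑ p →
    All (λ ψ → Forces p ψ ρ) Γ → All (λ ψ → Forces q ψ ρ) Γ
  sounds-wkF : ∀ {Γ : List (Formula n)} {ρ d} →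
    All (λ ψ → Forces p ψ ρ) Γ → All (λ ψ → Forces p ψ (d ∷ ρ)) (map wkF Γ)

  sounds-mono l = All.map (λ {ψ} → Forces-mono ψ l)
  sounds-wkF = map⁺ ∘ All.map (λ {ψ} → Forces-wkF⁻ ψ)

  sound (hyp i)        g = All.lookup g i
  sound {φ = φ} (⊥E d) g = Forces-Bad φ (sound d g)
  sound {φ = φ} (raa d) g = Forces-stable φ (λ l k → sound d (k ∷ sounds-mono l g))
  sound (⇒I d)         g = λ l x → sound d (x ∷ sounds-mono l g)
  sound (⇒E d e)       g = sound d g ⊑-refl (sound e g)
  sound (∧I d e)       g = sound d g , sound e g
  sound (∧E₁ d)        g = proj₁ (sound d g)
  sound (∧E₂ d)        g = proj₂ (sound d g)
  sound {φ = φ ∨' _} (∨I₁ d) g = λ l f _ → f ⊑-refl (Forces-mono φ l (sound d g))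
  sound {φ = _ ∨' ψ} (∨I₂ d) g = λ l _ f → f ⊑-refl (Forces-mono ψ l (sound d g))
  sound {φ = χ} (∨E d e f) g = Forces-stable χ λ l k →
    sound d g l (λ l′ x → k l′ (sound e (x ∷ sounds-mono (⊑-trans l′ l) g)))
                (λ l′ x → k l′ (sound f (x ∷ sounds-mono (⊑-trans l′ l) g)))
  sound (∀I d)         g = λ x → sound d (sounds-wkF g)
  sound (∀E {φ} d t)   g = Forces-[]⁻ φ t (sound d g (ev t _))
  sound (∃I {φ} t d)   g = Forces-∃I {φ = φ} (ev t _) (Forces-[] φ t (sound d g))
  sound (∃E {φ} {χ} d e) g = Forces-∃E {φ = φ} χ (sound d g)
    (λ x l y → Forces-wkF χ (sound e (y ∷ sounds-wkF (sounds-mono l g))))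
  sound (≐refl t)      g = Eq-refl
  sound (≐subst {s} {t} φ d e) g = Forces-[]⁻ φ t
    (Forces-resp (λ { zero → sound d g ; (suc i) → Eq-refl }) φ (Forces-[] φ s (sound e g)))

  Forces-close : ∀ n (φ : Formula n) → (∀ ρ → Forces p φ ρ) → Forces p (close n φ) []
  Forces-close zero    φ f = f []
  Forces-close (suc n) φ f = Forces-close n (∀' φ) (λ ρ d → f (d ∷ ρ))

  Forces-close⁻ : ∀ n (φ : Formula n) → Forces p (close n φ) [] → ∀ ρ → Forces p φ ρ
  Forces-close⁻ zero    φ f []      = f
  Forces-close⁻ (suc n) φ f (d ∷ ρ) = Forces-close⁻ n (∀' φ) f ρ d

-- The standard model

-- A single condition that is never bad: forcing becomes the double-negation translation of truth in
-- ℕ, for which classical derivations are sound constructively.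
standard : Frame
standard = record
  { Cond = ⊤ ; _⊑_ = λ _ _ → ⊤ ; ⊑-refl = tt ; ⊑-trans = λ _ _ → tt
  ; Bad = λ _ → ⊥ ; Bad-mono = λ _ b → b
  ; D = ℕ ; 0D = 0 ; 1D = 1 ; _+D_ = _+_ ; _*D_ = _*_
  ; Eq = λ _ → _≡_ ; Lt = λ _ → _<_ ; Eq-mono = λ _ e → e ; Lt-mono = λ _ l → l
  ; Eq-stable = λ h → decidable-stable (_ ≟ _) (λ k → h tt (λ _ → k))
  ; Lt-stable = λ h → decidable-stable (_ <? _) (λ k → h tt (λ _ → k))
  ; Eq-refl = refl ; Eq-sym = sym ; Eq-trans = trans
  ; Eq-+ = cong₂ _+_ ; Eq-* = cong₂ _*_ ; Lt-resp = λ { refl refl l → l }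
  }

module 𝕊 = Frame standard

val : Term n → Vec ℕ n → ℕ
val = 𝕊.ev

True : Formula n → Vec ℕ n → Set
True = 𝕊.Forces tt

-- Disjunctions and existentials are read positively here. On Δ₀ formulas this reading is decidable
-- and therefore agrees with `True`.
Holds : Formula n → Vec ℕ n → Set
Holds ⊥'       ρ = ⊥
Holds (s ≐ t)  ρ = val s ρ ≡ val t ρ
Holds (s ≺ t)  ρ = val s ρ < val t ρ
Holds (φ ∧' ψ) ρ = Holds φ ρ × Holds ψ ρ
Holds (φ ∨' ψ) ρ = Holds φ ρ ⊎ Holds ψ ρ
Holds (φ ⇒ ψ)  ρ = Holds φ ρ → Holds ψ ρ
Holds (∀' φ)   ρ = ∀ d → Holds φ (d ∷ ρ)
Holds (∃' φ)   ρ = Σ ℕ λ d → Holds φ (d ∷ ρ)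

<-wkT : ∀ (t : Term n) {x d ρ} → x < val t ρ → x < val (wkT t) (d ∷ ρ)
<-wkT t = subst (_ <_) (sym (𝕊.ev-wkT t))

<-wkT⁻ : ∀ (t : Term n) {x d ρ} → x < val (wkT t) (d ∷ ρ) → x < val t ρ
<-wkT⁻ t = subst (_ <_) (𝕊.ev-wkT t)

holds? : Δ₀ φ → ∀ ρ → Dec (Holds φ ρ)
holds? d⊥       ρ = no λ ()
holds? (d≐ s t) ρ = val s ρ ≟ val t ρ
holds? (d≺ s t) ρ = val s ρ <? val t ρ
holds? (d∧ d e) ρ = holds? d ρ ×-dec holds? e ρ
holds? (d∨ d e) ρ = holds? d ρ ⊎-dec holds? e ρ
holds? (d⇒ d e) ρ = holds? d ρ →-dec holds? e ρ
holds? (d∀< t d) ρ = map′ (λ f x l → f (<-wkT⁻ t l)) (λ f {x} l → f x (<-wkT t l))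
  (allUpTo? (λ x → holds? d (x ∷ ρ)) (val t ρ))
holds? (d∃< t d) ρ = map′ (λ { (x , l , h) → x , <-wkT t l , h }) (λ { (x , l , h) → x , <-wkT⁻ t l , h })
  (anyUpTo? (λ x → holds? d (x ∷ ρ)) (val t ρ))

mutual
  True⇒Holds : Δ₀ φ → ∀ {ρ} → True φ ρ → Holds φ ρ
  True⇒Holds (d≐ s t) x = x
  True⇒Holds (d≺ s t) x = x
  True⇒Holds (d∧ d e) (x , y) = True⇒Holds d x , True⇒Holds e y
  True⇒Holds (d∨ d e) x = decidable-stable (holds? (d∨ d e) _)
    λ k → x tt (λ _ → k ∘ inj₁ ∘ True⇒Holds d) (λ _ → k ∘ inj₂ ∘ True⇒Holds e)
  True⇒Holds (d⇒ d e) x y = True⇒Holds e (x tt (Holds⇒True d y))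
  True⇒Holds (d∀< t d) x z l = True⇒Holds d (x z tt l)
  True⇒Holds (d∃< t d) x = decidable-stable (holds? (d∃< t d) _)
    λ k → x tt (λ { z _ (l , y) → k (z , l , True⇒Holds d y) })

  Holds⇒True : Δ₀ φ → ∀ {ρ} → Holds φ ρ → True φ ρ
  Holds⇒True (d≐ s t) x = x
  Holds⇒True (d≺ s t) x = x
  Holds⇒True (d∧ d e) (x , y) = Holds⇒True d x , Holds⇒True e y
  Holds⇒True (d∨ d e) (inj₁ x) _ f _ = f tt (Holds⇒True d x)
  Holds⇒True (d∨ d e) (inj₂ x) _ _ f = f tt (Holds⇒True e x)
  Holds⇒True (d⇒ d e) x _ y = Holds⇒True e (x (True⇒Holds d y))
  Holds⇒True (d∀< t d) x z _ l = Holds⇒True d (x z l)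
  Holds⇒True (d∃< t d) (z , l , x) _ k = k z tt (l , Holds⇒True d x)

module _ (F : Frame) where
  open Frame F

  -- The interface shared by the two frames: decidability gives it for ℕ, Łoś's theorem for the
  -- nonstandard model.
  Δ₀-Valid : Set
  Δ₀-Valid = ∀ {n} {φ : Formula n} → Δ₀ φ → (∀ ρ → Holds φ ρ) → ∀ p ρ → Forces p φ ρ

  -- Keeps the formula visible to unification, which Forces p φ [] alone does not.
  record Forced (p : Cond) (φ : Formula 0) : Set where
    constructor forced
    field forces : Forces p φ []
  open Forced

  forces-Pminus : Δ₀-Valid → ∀ {φ} → Pminus φ → ∀ p → Forces p φ []
  forces-Pminus V a p = forces (go a)
    where
    valid : ∀ n {φ : Formula n} → Δ₀ φ → (∀ ρ → Holds φ ρ) → Forced p (close n φ)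
    valid n {φ} d h = forced (Forces-close n φ (V d h p))
    trichotomy : ∀ a b → b < a ⊎ b ≡ a ⊎ a < b
    trichotomy a b with <-cmp b a
    ... | tri< l _ _ = inj₁ l
    ... | tri≈ _ e _ = inj₂ (inj₁ e)
    ... | tri> _ _ l = inj₂ (inj₂ l)
    -- `ax-` has an unbounded existential; bounding the difference by the minuend makes it Δ₀, and
    -- the bound is dropped afterwards.
    ∃-difference : Formula 2
    ∃-difference = v1 ≺ v0 ⇒ ∃' (v0 ≺ (v1 ⊕ one) ∧' v2 ⊕ v0 ≐ v1)
    go : ∀ {φ} → Pminus φ → Forced p φ
    go ax+comm  = valid 2 (d≐ _ _) (λ { (a ∷ b ∷ []) → +-comm b a })
    go ax+assoc = valid 3 (d≐ _ _) (λ { (a ∷ b ∷ c ∷ []) → +-assoc c b a })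
    go ax*comm  = valid 2 (d≐ _ _) (λ { (a ∷ b ∷ []) → *-comm b a })
    go ax*assoc = valid 3 (d≐ _ _) (λ { (a ∷ b ∷ c ∷ []) → *-assoc c b a })
    go axdistr  = valid 3 (d≐ _ _) (λ { (a ∷ b ∷ c ∷ []) → *-distribˡ-+ c b a })
    go ax0      = valid 1 (d∧ (d≐ _ _) (d≐ _ _)) (λ { (a ∷ []) → +-identityʳ a , *-zeroʳ a })
    go ax1      = valid 1 (d≐ _ _) (λ { (a ∷ []) → *-identityʳ a })
    go ax<irr   = valid 1 (d⇒ (d≺ _ _) d⊥) (λ { (a ∷ []) → <-irrefl refl })
    go ax<trans = valid 3 (d⇒ (d∧ (d≺ _ _) (d≺ _ _)) (d≺ _ _))
      (λ { (a ∷ b ∷ c ∷ []) (l , l′) → <-trans l l′ })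
    go ax<tot   = valid 2 (d∨ (d≺ _ _) (d∨ (d≐ _ _) (d≺ _ _))) (λ { (a ∷ b ∷ []) → trichotomy a b })
    go ax<+     = valid 3 (d⇒ (d≺ _ _) (d≺ _ _)) (λ { (a ∷ b ∷ c ∷ []) l → +-monoˡ-< a l })
    go ax<*     = valid 3 (d⇒ (d∧ (d≺ _ _) (d≺ _ _)) (d≺ _ _))
      (λ { (zero ∷ b ∷ c ∷ []) (() , _) ; (suc a ∷ b ∷ c ∷ []) (_ , l) → *-monoˡ-< (suc a) l })
    go ax-      = forced λ x y {q} l lt → Forces-∃E {p = q} {φ = v0 ≺ (v1 ⊕ one) ∧' v2 ⊕ v0 ≐ v1}
      (∃' (v2 ⊕ v0 ≐ v1)) {y ∷ x ∷ []} {y ∷ x ∷ []}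
      (forces (valid 2 {∃-difference} (d⇒ (d≺ _ _) (d∃< (v0 ⊕ one) (d≐ _ _)))
        (λ { (a ∷ b ∷ []) l → a ∸ b , subst (a ∸ b <_) (+-comm 1 a) (s≤s (m∸n≤m a b))
                            , m+[n∸m]≡n (<⇒≤ l) })) x y l lt)
      (λ { d _ (_ , e) → Forces-∃I {φ = v2 ⊕ v0 ≐ v1} {y ∷ x ∷ []} d e })
    go ax01     = forced
      ( forces (valid 0 {zer ≺ one} (d≺ _ _) (λ _ → s≤s z≤n))
      , forces (valid 1 {zer ≺ v0 ⇒ (one ≺ v0) ∨' (one ≐ v0)} (d⇒ (d≺ _ _) (d∨ (d≺ _ _) (d≐ _ _)))
        (λ { (zero ∷ []) () ; (suc zero ∷ []) _ → inj₂ refl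
           ; (suc (suc a) ∷ []) _ → inj₁ (s≤s (s≤s z≤n)) })))
    go ax0min   = valid 1 (d∨ (d≺ _ _) (d≐ _ _))
      (λ { (zero ∷ []) → inj₂ refl ; (suc a ∷ []) → inj₁ (s≤s z≤n) })

True-Ind : ∀ (φ : Formula (suc n)) ρ → True (Ind φ) ρ
True-Ind φ ρ _ (z , s) = go
  where
  go : ∀ d → True φ (d ∷ ρ)
  go zero    = 𝕊.Forces-[] φ zer z
  go (suc d) = subst (λ x → True φ (x ∷ ρ)) (+-comm d 1)
    (𝕊.Forces-subF {ρ′ = d + 1 ∷ ρ} (λ { zero → refl ; (suc i) → refl }) φ (s d tt (go d)))

-- Gödel's β-function

coprime-* : ∀ {m n o} → Coprime m o → Coprime n o → Coprime (m * n) o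
coprime-* c c′ (g∣mn , g∣o) =
  c′ (coprime-divisor (λ { (h∣g , h∣m) → c (h∣m , ∣-trans h∣g g∣o) }) g∣mn , g∣o)

-- `u` inverts `m` modulo `suc n`. Multiples of the modulus on both sides replace the subtraction in
-- Bézout's identity.
inverse-mod : ∀ {m n} → Coprime m (suc n) →
  ∃[ u ] ∃[ α ] ∃[ β ] u * m + α * suc n ≡ 1 + β * suc n
inverse-mod {m} {n} c with coprime-Bézout c
... | Bézout.+- x y e = x , 0 , y , trans (+-identityʳ (x * m)) (sym e)
-- Here `x * m` is -1 modulo `suc n`, and so is `n`; hence `n * x` is the inverse.
... | Bézout.-+ x y e = n * x , 1 , n * y , (begin
  n * x * m + 1 * suc n         ≡⟨ lemma₁ n x m ⟩
  1 + n * (1 + x * m)           ≡⟨ cong (λ z → 1 + n * z) e ⟩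
  1 + n * (y * suc n)           ≡⟨ cong (1 +_) (sym (*-assoc n y (suc n))) ⟩
  1 + n * y * suc n             ∎)
  where
  open ≡-Reasoning
  lemma₁ : ∀ n x m → n * x * m + 1 * suc n ≡ 1 + n * (1 + x * m)
  lemma₁ = solve-∀

solve-mod : ∀ {m n} → Coprime m (suc n) → ∀ a v → v < suc n →
  ∃[ t ] t < suc n × (a + t * m) % suc n ≡ v
solve-mod {m} {n} cop a v v<d = t , m%n<n t₀ d , (begin
  (a + t * m) % d                                  ≡⟨ [m+kn]%n≡m%n (a + t * m) (t₀ / d * m + α * c) d ⟨
  (a + t * m + (t₀ / d * m + α * c) * d) % d       ≡⟨ cong (_% d) lemma ⟩
  (v + (a + c * β) * d) % d                        ≡⟨ [m+kn]%n≡m%n v (a + c * β) d ⟩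
  v % d                                            ≡⟨ m<n⇒m%n≡m v<d ⟩
  v                                                ∎)
  where
  open ≡-Reasoning
  d = suc n
  u = proj₁ (inverse-mod cop)
  α = proj₁ (proj₂ (inverse-mod cop))
  β = proj₁ (proj₂ (proj₂ (inverse-mod cop)))
  e : u * m + α * d ≡ 1 + β * d
  e = proj₂ (proj₂ (proj₂ (inverse-mod cop)))
  -- Since `n` is -1 modulo `d`, this is `v - a`, the amount that `t * m` has to contribute.
  c = v + n * a
  t₀ = c * u
  t = t₀ % d
  r₁ : ∀ a t m q α c n → a + t * m + (q * m + α * c) * suc n ≡ a + (t + q * suc n) * m + α * c * suc n
  r₁ = solve-∀
  r₂ : ∀ a c u m α n → a + c * u * m + α * c * suc n ≡ a + c * (u * m + α * suc n)
  r₂ = solve-∀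
  r₃ : ∀ a v n β → a + (v + n * a) * (1 + β * suc n) ≡ v + (a + (v + n * a) * β) * suc n
  r₃ = solve-∀
  lemma : a + t * m + (t₀ / d * m + α * c) * d ≡ v + (a + c * β) * d
  lemma = begin
    a + t * m + (t₀ / d * m + α * c) * d  ≡⟨ r₁ a t m (t₀ / d) α c n ⟩
    a + (t + t₀ / d * d) * m + α * c * d  ≡⟨ cong (λ z → a + z * m + α * c * d) (m≡m%n+[m/n]*n t₀ d) ⟨
    a + c * u * m + α * c * d             ≡⟨ r₂ a c u m α n ⟩
    a + c * (u * m + α * d)               ≡⟨ cong (λ z → a + c * z) e ⟩
    a + c * (1 + β * d)                   ≡⟨ r₃ a v n β ⟩
    v + (a + c * β) * d                   ∎

modulus : ℕ → ℕ → ℕ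
modulus b i = 1 + (i + 1) * b

-- A common divisor `g` is coprime to `b` because it divides `1 + (i + 1) * b`. It also divides the
-- difference `b * (j ∸ i)` of the moduli, hence `j ∸ i`, hence `b`, and so it is 1.
moduli-coprime : ∀ {b i j} → i < j → j ∸ i ∣ b → Coprime (modulus b i) (modulus b j)
moduli-coprime {b} {i} {j} i<j j∸i∣b {g} (g∣i , g∣j) = g⊥b (∣-refl , ∣-trans g∣j∸i j∸i∣b)
  where
  shift : ∀ i k b → 1 + (i + k + 1) * b ≡ (1 + (i + 1) * b) + b * k
  shift = solve-∀
  j≡ : modulus b j ≡ modulus b i + b * (j ∸ i)
  j≡ = trans (cong (modulus b) (sym (m+[n∸m]≡n (<⇒≤ i<j)))) (shift i (j ∸ i) b)
  g⊥b : Coprime g b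
  g⊥b {h} (h∣g , h∣b) = ∣1⇒≡1 (∣m+n∣m⇒∣n {h} {(i + 1) * b} {1} (subst (h ∣_) (+-comm 1 ((i + 1) * b)) (∣-trans h∣g g∣i)) (∣n⇒∣m*n (i + 1) h∣b))
  g∣j∸i : g ∣ j ∸ i
  g∣j∸i = coprime-divisor g⊥b (∣m+n∣m⇒∣n (subst (g ∣_) j≡ g∣j) g∣i)

moduli-product : ℕ → ℕ → ℕ
moduli-product b zero    = 1
moduli-product b (suc l) = modulus b l * moduli-product b l

moduli-product-coprime : ∀ {b} l {j} → (∀ {i} → i < l → i < j × j ∸ i ∣ b) →
  Coprime (moduli-product b l) (modulus b j)
moduli-product-coprime zero    h = Coprime.1-coprimeTo _
moduli-product-coprime (suc l) h =
  coprime-* (let l<j , d = h ≤-refl in moduli-coprime l<j d)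
            (moduli-product-coprime l (λ i<l → h (m≤n⇒m≤1+n i<l)))

crt : ∀ {b} l (v : ℕ → ℕ) → (∀ {k} → 0 < k → k < l → k ∣ b) → (∀ {i} → i < l → v i < modulus b i) →
  ∃[ a ] a < moduli-product b l × (∀ {i} → i < l → a % modulus b i ≡ v i)
crt zero v _ _ = 0 , s≤s z≤n , λ ()
crt {b} (suc l) v h v< = a′ , a′< , at
  where
  open ≡-Reasoning
  P = moduli-product b l
  IH = crt {b} l v (λ 0<k k<l → h 0<k (m≤n⇒m≤1+n k<l)) (λ i<l → v< (m≤n⇒m≤1+n i<l))
  a = proj₁ IH
  S = solve-mod (moduli-product-coprime l (λ {i} i<l → i<l , h (m<n⇒0<n∸m i<l) (s≤s (m∸n≤m l i)))) a (v l) (v< ≤-refl)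
  t = proj₁ S
  a′ = a + t * P
  a′< : a′ < modulus b l * P
  a′< = ≤-trans (+-monoˡ-≤ (t * P) (proj₁ (proj₂ IH))) (*-monoˡ-≤ P (proj₁ (proj₂ S)))
  divides-product : ∀ k {i} → i < k → ∃[ q ] moduli-product b k ≡ q * modulus b i
  divides-product (suc k) {i} (s≤s i≤k) with m≤n⇒m<n∨m≡n i≤k
  ... | inj₂ refl = moduli-product b k , *-comm (modulus b k) (moduli-product b k)
  ... | inj₁ i<k  = let q , e = divides-product k i<k in
    modulus b k * q , trans (cong (modulus b k *_) e) (sym (*-assoc (modulus b k) q (modulus b i)))
  at : ∀ {i} → i < suc l → a′ % modulus b i ≡ v i
  at {i} (s≤s i≤l) with m≤n⇒m<n∨m≡n i≤l
  ... | inj₂ refl = proj₂ (proj₂ S)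
  ... | inj₁ i<l  = let q , e = divides-product l i<l in begin
    (a + t * P) % modulus b i                  ≡⟨ cong (λ z → (a + t * z) % modulus b i) e ⟩
    (a + t * (q * modulus b i)) % modulus b i  ≡⟨ cong (λ z → (a + z) % modulus b i) (sym (*-assoc t q (modulus b i))) ⟩
    (a + t * q * modulus b i) % modulus b i    ≡⟨ [m+kn]%n≡m%n a (t * q) (modulus b i) ⟩
    a % modulus b i                            ≡⟨ proj₂ (proj₂ IH) i<l ⟩
    v i                                        ∎

-- The relation `Rem` of the coding convention with its quotient bounded, so that it can be
-- expressed by the Δ₀ formula `entryΔ`.
Entry : ℕ → ℕ → ℕ → ℕ → Set
Entry a b i m = m < modulus b i × Σ ℕ λ q → q < a + 1 × a ≡ q * modulus b i + m

Entry-% : ∀ {a b i m} → a % modulus b i ≡ m → Entry a b i m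
Entry-% {a} {b} {i} refl = m%n<n a d , a / d , subst (a / d <_) (+-comm 1 a) (s≤s (m/n≤m a d))
                         , trans (m≡m%n+[m/n]*n a d) (+-comm (a % d) (a / d * d))
  where d = modulus b i

remainder-unique : ∀ {a d q m} → m < suc d → a ≡ q * suc d + m → m ≡ a % suc d
remainder-unique {d = d} {q} {m} m< refl = begin
  m                        ≡⟨ m<n⇒m%n≡m m< ⟨
  m % suc d                ≡⟨ [m+kn]%n≡m%n m q (suc d) ⟨
  (m + q * suc d) % suc d  ≡⟨ cong (_% suc d) (+-comm m (q * suc d)) ⟩
  (q * suc d + m) % suc d  ∎
  where open ≡-Reasoning

Entry-unique : ∀ {a b i m m′} → Entry a b i m → Entry a b i m′ → m ≡ m′
Entry-unique (l , q , _ , e) (l′ , q′ , _ , e′) =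
  trans (remainder-unique {q = q} l e) (sym (remainder-unique {q = q′} l′ e′))

Entry-≤ : ∀ {a b i m} → Entry a b i m → m ≤ a
Entry-≤ {b = b} {i} {m} (_ , q , _ , refl) = m≤n+m m (q * modulus b i)

-- The factor `l !` is divisible by every difference of indices below `l`, and `suc M` makes the
-- moduli exceed the entries. The bound on `a` is for the nonstandard model, where the code of a
-- chain must itself lie below some standard level.
encode : ∀ l M (v : ℕ → ℕ) → (∀ {i} → i < l → v i ≤ M) →
  ∃[ a ] a < moduli-product (l ! * suc M) l × (∀ {i} → i < l → Entry a (l ! * suc M) i (v i))
encode l M v v≤ with crt {l ! * suc M} l v k∣b v<
  where
  k∣b : ∀ {k} → 0 < k → k < l → k ∣ l ! * suc M
  k∣b {suc k} _ k<l = ∣m⇒∣m*n (suc M) (∣-trans (m∣m*n (k !)) (m≤n⇒m!∣n! (<⇒≤ k<l)))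
  v< : ∀ {i} → i < l → v i < modulus (l ! * suc M) i
  v< {i} i<l = s≤s (begin
    v i                                ≤⟨ v≤ i<l ⟩
    M                                  ≤⟨ n≤1+n M ⟩
    suc M                              ≡⟨ *-identityˡ (suc M) ⟨
    1 * suc M                          ≤⟨ *-monoˡ-≤ (suc M) (1≤n! l) ⟩
    l ! * suc M                        ≡⟨ *-identityˡ _ ⟨
    1 * (l ! * suc M)                  ≤⟨ *-monoˡ-≤ (l ! * suc M) (m≤n+m 1 i) ⟩
    (i + 1) * (l ! * suc M)            ∎)
    where open ≤-Reasoning
... | a , a< , e = a , a< , λ {i} i<l → Entry-% {i = i} (e i<l)

bounded-on-prefix : ∀ l (v : ℕ → ℕ) → ∃[ M ] ∀ {i} → i < l → v i ≤ M
bounded-on-prefix zero    v = 0 , λ ()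
bounded-on-prefix (suc l) v = let M , h = bounded-on-prefix l v in
  v l ⊔ M , λ { {i} (s≤s i≤l) → [ (λ i<l → ≤-trans (h i<l) (m≤n⊔m (v l) M))
                              , (λ { refl → m≤m⊔n (v l) M }) ]′ (m≤n⇒m<n∨m≡n i≤l) }

-- Codes for the Cantor pairing.

triangle : ℕ → ℕ
triangle zero    = 0
triangle (suc n) = suc n + triangle n

triangle-double : ∀ n → n * (n + 1) ≡ triangle n + triangle n
triangle-double zero    = refl
triangle-double (suc n) = begin
  suc n * (suc n + 1)                                  ≡⟨ r₁ n ⟩
  (suc n + suc n) + n * (n + 1)                        ≡⟨ cong ((suc n + suc n) +_) (triangle-double n) ⟩
  (suc n + suc n) + (triangle n + triangle n)          ≡⟨ r₂ (suc n) (triangle n) ⟩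
  (suc n + triangle n) + (suc n + triangle n)          ∎
  where
  open ≡-Reasoning
  r₁ : ∀ n → suc n * (suc n + 1) ≡ (suc n + suc n) + n * (n + 1)
  r₁ = solve-∀
  r₂ : ∀ a b → (a + a) + (b + b) ≡ (a + b) + (a + b)
  r₂ = solve-∀

cantor : ∀ u w → ∃[ p ] (u + w) * (u + w + 1) + (u + u) ≡ p + p
cantor u w = triangle (u + w) + u ,
  trans (cong (_+ (u + u)) (triangle-double (u + w))) (r (triangle (u + w)) u)
  where
  r : ∀ a b → (a + a) + (b + b) ≡ (a + b) + (a + b)
  r = solve-∀

-- Approximations of a partial function, and the truth of `PΣ₁` in ℕ.

module _ (Φ : ℕ → ℕ → Set) (functional : ∀ {x y y′} → Φ x y → Φ x y′ → y ≡ y′) where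

  -- Whether `Φ` has a value at `m` is not decidable, so the bound exists only under double
  -- negation; a forced existential asks for no more.
  values-bounded : ∀ m → ¬ ¬ (∃[ B ] ∀ {x y} → x < m → Φ x y → y ≤ B)
  values-bounded zero    k = k (0 , λ ())
  values-bounded (suc m) k = values-bounded m λ { (B , h) →
    let undefined-at-m : ∀ y → ¬ Φ m y
        undefined-at-m y f = k (y ⊔ B , λ { (s≤s x≤m) g →
          [ (λ x<m → ≤-trans (h x<m g) (m≤n⊔m y B))
          , (λ { refl → ≤-trans (≤-reflexive (functional g f)) (m≤m⊔n y B) }) ]′ (m≤n⇒m<n∨m≡n x≤m) })
    in k (B , λ { (s≤s x≤m) g →
          [ (λ x<m → h x<m g) , (λ { refl → ⊥-elim (undefined-at-m _ g) }) ]′ (m≤n⇒m<n∨m≡n x≤m) }) }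

  Dominates : ℕ → (ℕ → ℕ) → Set
  Dominates z v = ∀ i → i + 1 < z → ∀ {x y} → x ≤ v i → Φ x y → y ≤ v (i + 1)

  -- The entry following `v z` is a common bound of the values of `Φ` at the finitely many arguments
  -- up to `v z`.
  approximation : ∀ z → ¬ ¬ (∃[ v ] Dominates z v)
  approximation zero          k = k ((λ _ → 0) , λ _ ())
  approximation (suc zero)    k = k ((λ _ → 0) , λ i l → contradiction (≤-<-trans (m≤n+m 1 i) l) (<-irrefl refl))
  approximation (suc (suc z)) k = approximation (suc z) λ { (v , h) → values-bounded (suc (v z)) λ { (B , b) →
    let v′ : ℕ → ℕ
        v′ i = extend v B i
        old : ∀ {i} → i ≤ z → v′ i ≡ v i
        old {i} i≤z = extend-≤ v B i≤z
        new : v′ (z + 1) ≡ B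
        new = extend-> v B (subst (z <_) (+-comm 1 z) ≤-refl)
    in k (v′ , λ i l {x} {y} x≤ f → [ (λ i<z → subst (y ≤_) (sym (old (subst (_≤ z) (+-comm 1 i) i<z)))
                                          (h i (s≤s (subst (_≤ z) (+-comm 1 i) i<z))
                                             (subst (x ≤_) (old (<⇒≤ i<z)) x≤) f))
                           , (λ { refl → subst (y ≤_) (sym new)
                                          (b (s≤s (subst (x ≤_) (old ≤-refl) x≤)) f) })
                           ]′ (m≤n⇒m<n∨m≡n (+-cancelʳ-≤ 1 i z (subst (i + 1 ≤_) (+-comm 1 z) (≤-pred l))))) } }
    where
    extend : (ℕ → ℕ) → ℕ → ℕ → ℕ
    extend v B i with i ≤? z
    ... | yes _ = v i
    ... | no _  = B
    extend-≤ : ∀ v B {i} → i ≤ z → extend v B i ≡ v i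
    extend-≤ v B {i} l with i ≤? z
    ... | yes _ = refl
    ... | no ¬l = contradiction l ¬l
    extend-> : ∀ v B {i} → z < i → extend v B i ≡ B
    extend-> v B {i} l with i ≤? z
    ... | yes l′ = contradiction l′ (<⇒≱ l)
    ... | no _   = refl

True-Pax : ∀ (φ : Formula (suc (suc n))) ρ → True (Pax φ) ρ
True-Pax {n} φ ρ _ pfun z _ k = approximation Φ functional z λ { (v , h) →
  let M , v≤M          = bounded-on-prefix z v
      a , _ , entries  = encode z M v v≤M
      b                = z ! * suc M
      c , pair-c       = cantor a b
      s , pair-s       = cantor z c
  in k s tt λ _ k → k z tt λ _ k → k c tt λ _ k → k a tt λ _ k → k b tt
       (pair-s , pair-c , refl , λ i _ i+1<z x y e e′ _ (r , r′ , x≤e , f) →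
          conclude z v h entries i i+1<z x y e e′ (r , r′ , x≤e ,
            𝕊.Forces-subF {ρ′ = x ∷ y ∷ ρ} (λ { zero → refl ; (suc zero) → refl ; (suc (suc i)) → refl }) φ f)) }
  where
  Φ : ℕ → ℕ → Set
  Φ x y = True φ (x ∷ y ∷ ρ)
  functional : ∀ {x y y′} → Φ x y → Φ x y′ → y ≡ y′
  functional {x} {y} {y′} f g = pfun x y y′ tt
    ( 𝕊.Forces-subF⁻ {ρ′ = x ∷ y ∷ ρ} (λ { zero → refl ; (suc zero) → refl ; (suc (suc i)) → refl }) φ f
    , 𝕊.Forces-subF⁻ {ρ′ = x ∷ y′ ∷ ρ} (λ { zero → refl ; (suc zero) → refl ; (suc (suc i)) → refl }) φ g)
  conclude : ∀ z v (h : Dominates Φ functional z v) {a b} (entries : ∀ {i} → i < z → Entry a b i (v i))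
    i (i+1<z : i + 1 < z) x y e e′ →
    let η = e′ ∷ e ∷ y ∷ x ∷ i ∷ b ∷ a ∷ [] in
    True (Rem v6 (one ⊕ ((v4 ⊕ one) ⊗ v5)) v1) η ×
    True (Rem v6 (one ⊕ ((v4 ⊕ one ⊕ one) ⊗ v5)) v0) η ×
    True (Le v3 v1) η × Φ x y →
    True (Le v2 v0) η
  conclude z v h {a} {b} entries i i+1<z x y e e′ ((e< , ∃q) , (e′< , ∃q′) , x≤e , f) =
    𝕊.Forces-stable (Le v2 v0) {e′ ∷ e ∷ y ∷ x ∷ i ∷ b ∷ a ∷ []} λ _ k → ∃q tt λ q _ eq → ∃q′ tt λ q′ _ eq′ →
      let e≡  = trans (remainder-unique {q = q} e< eq) (sym (entry-≡ i (<-trans (subst (i <_) (+-comm 1 i) ≤-refl) i+1<z)))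
          e′≡ = trans (remainder-unique {q = q′} e′< eq′) (sym (entry-≡ (i + 1) i+1<z))
      in k tt (Holds⇒True (Δ₀-Le v2 v0) {e′ ∷ e ∷ y ∷ x ∷ i ∷ b ∷ a ∷ []}
           (m≤n⇒m<n∨m≡n (subst (y ≤_) (sym e′≡) (h i i+1<z (subst (x ≤_) e≡ x≤′) f))))
    where
    x≤′ : x ≤ e
    x≤′ = [ <⇒≤ , ≤-reflexive ]′ (True⇒Holds (Δ₀-Le v3 v1) {e′ ∷ e ∷ y ∷ x ∷ i ∷ b ∷ a ∷ []} x≤e)
    entry-≡ : ∀ i → i < z → v i ≡ a % modulus b i
    entry-≡ i l = let l′ , q , _ , eq = entries l in remainder-unique {q = q} l′ eq

Δ₀-Valid-standard : Δ₀-Valid standard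
Δ₀-Valid-standard d h _ ρ = Holds⇒True d (h ρ)

PΣ₁-true : ∀ {φ} → PΣ₁ φ → True φ []
PΣ₁-true (baseI (base a))      = forces-Pminus standard Δ₀-Valid-standard a tt
PΣ₁-true (baseI (ind {n} φ _)) = 𝕊.Forces-close n (Ind φ) (True-Ind φ)
PΣ₁-true (pax {n} φ _)         = 𝕊.Forces-close n (Pax φ) (True-Pax φ)

PΣ₁-theorems-true : ∀ {φ} → PΣ₁ ⊩ φ → True φ []
PΣ₁-theorems-true (Γ , Γ⊆ , d) = 𝕊.sound d (All.map PΣ₁-true Γ⊆)

-- Arithmetization of bounded computations

-- Not onto, but a polynomial without division, hence a term of the language. It is injective
-- because `⟨ u , w ⟩` lies between the square of `u + w` and the next square, which determines the
-- sum and then `u`.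
⟨_,_⟩ : ℕ → ℕ → ℕ
⟨ u , w ⟩ = (u + w) * (u + w) + u

⟨,⟩-<-root : ∀ u w {s} → u + w < s → ⟨ u , w ⟩ < s * s
⟨,⟩-<-root u w {s} r<s = begin-strict
  r * r + u      ≤⟨ +-monoʳ-≤ (r * r) (m≤m+n u w) ⟩
  r * r + r      ≡⟨ +-comm (r * r) r ⟩
  suc r * r      <⟨ m<n+m (suc r * r) {suc r} (s≤s z≤n) ⟩
  suc r + suc r * r ≡⟨ sym (*-suc (suc r) r) ⟩
  suc r * suc r  ≤⟨ *-mono-≤ r<s r<s ⟩
  s * s          ∎
  where
  open ≤-Reasoning
  r = u + w

⟨,⟩-injective : ∀ u w u′ w′ → ⟨ u , w ⟩ ≡ ⟨ u′ , w′ ⟩ → u ≡ u′ × w ≡ w′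
⟨,⟩-injective u w u′ w′ e = u≡ , +-cancelˡ-≡ u w w′ (trans s≡ (cong (_+ w′) (sym u≡)))
  where
  ≮-root : ∀ u w u′ w′ → ⟨ u , w ⟩ ≡ ⟨ u′ , w′ ⟩ → ¬ (u + w < u′ + w′)
  ≮-root u w u′ w′ e l = <-irrefl e (≤-trans (⟨,⟩-<-root u w l) (m≤m+n ((u′ + w′) * (u′ + w′)) u′))
  s≡ : u + w ≡ u′ + w′
  s≡ = ≤-antisym (≮⇒≥ (≮-root u′ w′ u w (sym e))) (≮⇒≥ (≮-root u w u′ w′ e))
  u≡ : u ≡ u′
  u≡ = +-cancelˡ-≡ ((u + w) * (u + w)) u u′ (trans e (cong (λ s → s * s + u′) (sym s≡)))

m≤m*m : ∀ m → m ≤ m * m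
m≤m*m zero    = z≤n
m≤m*m (suc m) = m≤m+n (suc m) (m * suc m)

⟨,⟩-≥ˡ : ∀ u w → u ≤ ⟨ u , w ⟩
⟨,⟩-≥ˡ u w = m≤n+m u ((u + w) * (u + w))

⟨,⟩-≥ʳ : ∀ u w → w ≤ ⟨ u , w ⟩
⟨,⟩-≥ʳ u w = ≤-trans (m≤n+m w u) (≤-trans (m≤m*m (u + w)) (m≤m+n _ u))

-- A small language of total programs.

data Arith : Set where
  add mul eq : Arith

-- Just enough to decide Δ₀ formulas: variable access, constants, sum, product, equality test and
-- bounded search. `tl` drops the head of the environment and `put` pushes a constant, so numerals
-- and parameters become part of the program.
data Code : Set where
  hd  : Code
  tl  : Code → Code
  put : ℕ → Code → Code
  bin : Arith → Code → Code → Code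
  ex  : Code → Code → Code

bit : ∀ {P : Set} → Dec P → ℕ
bit (yes _) = 1
bit (no _)  = 0

arith : Arith → ℕ → ℕ → ℕ
arith add p q = p + q
arith mul p q = p * q
arith eq  p q = bit (p ≟ q)

head : List ℕ → ℕ
head []      = 0
head (x ∷ _) = x

tail : List ℕ → List ℕ
tail []      = []
tail (_ ∷ ρ) = ρ

mutual
  eval : Code → List ℕ → ℕ
  eval hd          ρ = head ρ
  eval (tl c)      ρ = eval c (tail ρ)
  eval (put a c)   ρ = eval c (a ∷ ρ)
  eval (bin o c d) ρ = arith o (eval c ρ) (eval d ρ)
  eval (ex c d)    ρ = bit (ex? c d ρ)

  ex? : ∀ c d ρ → Dec (∃[ i ] i < eval c ρ × eval d (i ∷ ρ) ≢ 0)
  ex? c d ρ = anyUpTo? (λ i → ¬? (eval d (i ∷ ρ) ≟ 0)) (eval c ρ)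

index : Arith → ℕ
index add = 0
index mul = 1
index eq  = 2

index-injective : ∀ o o′ → index o ≡ index o′ → o ≡ o′
index-injective add add _ = refl
index-injective mul mul _ = refl
index-injective eq  eq  _ = refl

tag : Code → ℕ
tag hd          = 0
tag (tl _)      = 1
tag (put _ _)   = 2
tag (ex _ _)    = 3
tag (bin o _ _) = 4 + index o

mutual
  # : Code → ℕ
  # c = ⟨ tag c , payload c ⟩

  payload : Code → ℕ
  payload hd          = 0
  payload (tl c)      = # c
  payload (put a c)   = ⟨ a , # c ⟩
  payload (bin _ c d) = ⟨ # c , # d ⟩
  payload (ex c d)    = ⟨ # c , # d ⟩

-- The empty environment gets the code of the pair ⟨0,0⟩, matching head [] = 0 and tail [] = [].
encEnv : List ℕ → ℕ
encEnv []      = 0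
encEnv (x ∷ ρ) = ⟨ x , encEnv ρ ⟩

fact : ℕ → ℕ → ℕ → ℕ
fact e x y = ⟨ e , ⟨ x , y ⟩ ⟩

fact-injective : ∀ e x y e′ x′ y′ → fact e x y ≡ fact e′ x′ y′ → e ≡ e′ × x ≡ x′ × y ≡ y′
fact-injective e x y e′ x′ y′ h =
  let e≡ , r = ⟨,⟩-injective e ⟨ x , y ⟩ e′ ⟨ x′ , y′ ⟩ h in e≡ , ⟨,⟩-injective x y x′ y′ r

ArithSpec : Arith → ℕ → ℕ → ℕ → Set
ArithSpec add p q y = y ≡ p + q
ArithSpec mul p q y = y ≡ p * q
ArithSpec eq  p q y = p ≡ q × y ≡ 1 ⊎ ¬ p ≡ q × y ≡ 0

arith-spec : ∀ o p q → ArithSpec o p q (arith o p q)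
arith-spec add p q = refl
arith-spec mul p q = refl
arith-spec eq  p q with p ≟ q
... | yes e = inj₁ (e , refl)
... | no ¬e = inj₂ (¬e , refl)

arith-spec-unique : ∀ o {p q y} → ArithSpec o p q y → y ≡ arith o p q
arith-spec-unique add e = e
arith-spec-unique mul e = e
arith-spec-unique eq {p} {q} s with p ≟ q | s
... | yes _ | inj₁ (_ , y≡1)  = y≡1
... | yes e | inj₂ (¬e , _)   = contradiction e ¬e
... | no ¬e | inj₁ (e , _)    = contradiction e ¬e
... | no _  | inj₂ (_ , y≡0)  = y≡0

-- Every fact (code, environment, value) in `S` is backed by facts about its immediate subcalls. The
-- clauses range over arbitrary numbers rather than codes of actual programs, so they can be stated
-- by a Δ₀ formula about a coded list.
record Justified (S : ℕ → ℕ → ℕ → Set) : Set where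
  field
    j-hd  : ∀ u w y → S 0 ⟨ u , w ⟩ y → y ≡ u
    j-tl  : ∀ c u w y → S ⟨ 1 , c ⟩ ⟨ u , w ⟩ y → S c w y
    j-put : ∀ a c w y → S ⟨ 2 , ⟨ a , c ⟩ ⟩ w y → S c ⟨ a , w ⟩ y
    j-bin : ∀ o c d w y → S ⟨ 4 + index o , ⟨ c , d ⟩ ⟩ w y →
      ∃[ p ] ∃[ q ] S c w p × S d w q × ArithSpec o p q y
    j-ex  : ∀ c d w y → S ⟨ 3 , ⟨ c , d ⟩ ⟩ w y → ∃[ p ] S c w p ×
      (y ≡ 1 × (∃[ i ] i < p × ∃[ z ] S d ⟨ i , w ⟩ z × ¬ z ≡ 0)
       ⊎ y ≡ 0 × (∀ i → i < p → S d ⟨ i , w ⟩ 0))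

encEnv-pair : ∀ ρ → encEnv ρ ≡ ⟨ head ρ , encEnv (tail ρ) ⟩
encEnv-pair []      = refl
encEnv-pair (x ∷ ρ) = refl

bit-yes : ∀ {P : Set} (d : Dec P) → P → bit d ≡ 1
bit-yes (yes _) _ = refl
bit-yes (no ¬p) p = contradiction p ¬p

bit-no : ∀ {P : Set} (d : Dec P) → ¬ P → bit d ≡ 0
bit-no (yes p) ¬p = contradiction p ¬p
bit-no (no _)  _  = refl

module _ {S : ℕ → ℕ → ℕ → Set} (J : Justified S) where
  open Justified J

  -- The induction is on the actual program `c`; circular support among facts about numbers that
  -- code no program does no harm.
  justified-correct : ∀ c ρ y → S (# c) (encEnv ρ) y → y ≡ eval c ρ
  justified-correct hd ρ y s =
    j-hd (head ρ) (encEnv (tail ρ)) y (subst (λ x → S 0 x y) (encEnv-pair ρ) s)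
  justified-correct (tl c) ρ y s = justified-correct c (tail ρ) y
    (j-tl (# c) (head ρ) (encEnv (tail ρ)) y (subst (λ x → S (# (tl c)) x y) (encEnv-pair ρ) s))
  justified-correct (put a c) ρ y s = justified-correct c (a ∷ ρ) y (j-put a (# c) (encEnv ρ) y s)
  justified-correct (bin o c d) ρ y s with j-bin o (# c) (# d) (encEnv ρ) y s
  ... | p , q , s₁ , s₂ , sp with justified-correct c ρ p s₁ | justified-correct d ρ q s₂
  ... | refl | refl = arith-spec-unique o sp
  justified-correct (ex c d) ρ y s with j-ex (# c) (# d) (encEnv ρ) y s
  ... | p , s₁ , r with justified-correct c ρ p s₁
  justified-correct (ex c d) ρ y s | p , s₁ , inj₁ (refl , i , i< , z , s₂ , z≢0) | refl =
    sym (bit-yes (ex? c d ρ) (i , i< , subst (_≢ 0) (justified-correct d (i ∷ ρ) z s₂) z≢0))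
  justified-correct (ex c d) ρ y s | p , s₁ , inj₂ (refl , f) | refl =
    sym (bit-no (ex? c d ρ) (λ { (i , i< , ≢0) → ≢0 (sym (justified-correct d (i ∷ ρ) 0 (f i i<))) }))

-- Finite traces of a computation.

Call : Set
Call = Code × List ℕ

data SubCall : Call → Call → Set where
  tl   : ∀ {c ρ} → SubCall (c , tail ρ) (tl c , ρ)
  put  : ∀ {a c ρ} → SubCall (c , a ∷ ρ) (put a c , ρ)
  binˡ : ∀ {o c d ρ} → SubCall (c , ρ) (bin o c d , ρ)
  binʳ : ∀ {o c d ρ} → SubCall (d , ρ) (bin o c d , ρ)
  exˡ  : ∀ {c d ρ} → SubCall (c , ρ) (ex c d , ρ)
  exʳ  : ∀ {c d ρ i} → i < eval c ρ → SubCall (d , i ∷ ρ) (ex c d , ρ)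

CallClosed : List Call → Set
CallClosed L = ∀ {x y} → x ∈ L → SubCall y x → y ∈ L

CallClosed-++ : ∀ {L M} → CallClosed L → CallClosed M → CallClosed (L ++ M)
CallClosed-++ {L} cl cm i s = [ (λ j → ∈-++⁺ˡ (cl j s)) , (λ j → ∈-++⁺ʳ L (cm j s)) ]′ (∈-++⁻ L i)

CallClosed-∷ : ∀ {L x} → CallClosed L → (∀ {y} → SubCall y x → y ∈ L) → CallClosed (x ∷ L)
CallClosed-∷ cl f (here refl) s = there (f s)
CallClosed-∷ cl f (there i)   s = there (cl i s)

Trace : Call → Set
Trace x = ∃[ L ] CallClosed L × x ∈ L

trace : ∀ c ρ → Trace (c , ρ)
traces : ∀ c ρ k → ∃[ L ] CallClosed L × (∀ {i} → i < k → (c , i ∷ ρ) ∈ L)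

trace hd ρ = (hd , ρ) ∷ [] , CallClosed-∷ (λ ()) (λ ()) , here refl
trace (tl c) ρ =
  let L , cl , i = trace c (tail ρ) in _ , CallClosed-∷ cl (λ { tl → i }) , here refl
trace (put a c) ρ =
  let L , cl , i = trace c (a ∷ ρ) in _ , CallClosed-∷ cl (λ { put → i }) , here refl
trace (bin o c d) ρ =
  let L , cl , i = trace c ρ
      M , cm , j = trace d ρ
  in _ , CallClosed-∷ (CallClosed-++ cl cm) (λ { binˡ → ∈-++⁺ˡ i ; binʳ → ∈-++⁺ʳ L j }) , here refl
trace (ex c d) ρ =
  let L , cl , i = trace c ρ
      M , cm , j = traces d ρ (eval c ρ)
  in _ , CallClosed-∷ (CallClosed-++ cl cm) (λ { exˡ → ∈-++⁺ˡ i ; (exʳ l) → ∈-++⁺ʳ L (j l) }) , here refl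

traces c ρ zero    = [] , (λ ()) , λ ()
traces c ρ (suc k) =
  let L , cl , i = trace c (k ∷ ρ)
      M , cm , j = traces c ρ k
  in L ++ M , CallClosed-++ cl cm ,
     λ { (s≤s l) → [ (λ l′ → ∈-++⁺ʳ L (j l′)) , (λ { refl → ∈-++⁺ˡ i }) ]′ (m≤n⇒m<n∨m≡n l) }

module _ {S : ℕ → ℕ → ℕ → Set} {L : List Call} (closed : CallClosed L)
  (source : ∀ t u x y → S ⟨ t , u ⟩ x y →
    ∃[ c ] ∃[ ρ ] (c , ρ) ∈ L × t ≡ tag c × u ≡ payload c × x ≡ encEnv ρ × y ≡ eval c ρ)
  (L⇒S : ∀ {c ρ} → (c , ρ) ∈ L → S (# c) (encEnv ρ) (eval c ρ)) where

  trace-justified : Justified S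
  trace-justified = record { j-hd = j-hd ; j-tl = j-tl ; j-put = j-put ; j-bin = j-bin ; j-ex = j-ex }
    where
    unpair : ∀ u w ρ → ⟨ u , w ⟩ ≡ encEnv ρ → u ≡ head ρ × w ≡ encEnv (tail ρ)
    unpair u w ρ e = ⟨,⟩-injective u w (head ρ) (encEnv (tail ρ)) (trans e (encEnv-pair ρ))

    j-hd : ∀ u w y → S 0 ⟨ u , w ⟩ y → y ≡ u
    j-hd u w y s with source 0 0 ⟨ u , w ⟩ y s
    ... | hd , ρ , _ , _ , _ , e , refl = sym (proj₁ (unpair u w ρ e))

    j-tl : ∀ c u w y → S ⟨ 1 , c ⟩ ⟨ u , w ⟩ y → S c w y
    j-tl c u w y s with source 1 c ⟨ u , w ⟩ y s
    ... | tl c , ρ , i , _ , refl , e , refl with unpair u w ρ e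
    ... | _ , refl = L⇒S (closed i tl)

    j-put : ∀ a c w y → S ⟨ 2 , ⟨ a , c ⟩ ⟩ w y → S c ⟨ a , w ⟩ y
    j-put a c w y s with source 2 ⟨ a , c ⟩ w y s
    ... | put a′ c′ , ρ , i , _ , e , refl , refl with ⟨,⟩-injective a c a′ (# c′) e
    ... | refl , refl = L⇒S (closed i put)

    j-bin : ∀ o c d w y → S ⟨ 4 + index o , ⟨ c , d ⟩ ⟩ w y →
      ∃[ p ] ∃[ q ] S c w p × S d w q × ArithSpec o p q y
    j-bin o c d w y s with source (4 + index o) ⟨ c , d ⟩ w y s
    ... | bin o′ c′ d′ , ρ , i , t , e , refl , refl
      with index-injective o o′ (+-cancelˡ-≡ 4 (index o) (index o′) t) | ⟨,⟩-injective c d (# c′) (# d′) e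
    ... | refl | refl , refl =
      eval c′ ρ , eval d′ ρ , L⇒S (closed i binˡ) , L⇒S (closed i binʳ) , arith-spec o (eval c′ ρ) (eval d′ ρ)

    j-ex : ∀ c d w y → S ⟨ 3 , ⟨ c , d ⟩ ⟩ w y → ∃[ p ] S c w p ×
      (y ≡ 1 × (∃[ i ] i < p × ∃[ z ] S d ⟨ i , w ⟩ z × ¬ z ≡ 0)
       ⊎ y ≡ 0 × (∀ i → i < p → S d ⟨ i , w ⟩ 0))
    j-ex c d w y s with source 3 ⟨ c , d ⟩ w y s
    ... | ex c′ d′ , ρ , i , _ , e , refl , refl with ⟨,⟩-injective c d (# c′) (# d′) e
    ... | refl , refl = eval c′ ρ , L⇒S (closed i exˡ) , cases (ex? c′ d′ ρ)
      where
      cases : ∀ x →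
        bit x ≡ 1 × (∃[ i ] i < eval c′ ρ × ∃[ z ] S (# d′) ⟨ i , encEnv ρ ⟩ z × ¬ z ≡ 0)
        ⊎ bit x ≡ 0 × (∀ i → i < eval c′ ρ → S (# d′) ⟨ i , encEnv ρ ⟩ 0)
      cases (yes (k , k< , ≢0)) = inj₁ (refl , k , k< , eval d′ (k ∷ ρ) , L⇒S (closed i (exʳ k<)) , ≢0)
      cases (no none) = inj₂ (refl , λ k k< →
        subst (S (# d′) ⟨ k , encEnv ρ ⟩)
          (decidable-stable (_ ≟ _) (λ ≢0 → none (k , k< , ≢0))) (L⇒S (closed i (exʳ k<))))

-- Δ₀ formulas for traces, steps and chains.

Δ₀Formula : ℕ → Set
Δ₀Formula n = Σ (Formula n) Δ₀

infix  4 _≐Δ_ _≺Δ_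
infixr 3 _∧Δ_
infixr 2 _∨Δ_
infixr 1 _⇒Δ_

_≐Δ_ _≺Δ_ : Term n → Term n → Δ₀Formula n
s ≐Δ t = (s ≐ t) , d≐ s t
s ≺Δ t = (s ≺ t) , d≺ s t

_∧Δ_ _∨Δ_ _⇒Δ_ : Δ₀Formula n → Δ₀Formula n → Δ₀Formula n
(φ , d) ∧Δ (ψ , e) = (φ ∧' ψ) , d∧ d e
(φ , d) ∨Δ (ψ , e) = (φ ∨' ψ) , d∨ d e
(φ , d) ⇒Δ (ψ , e) = (φ ⇒ ψ) , d⇒ d e

¬Δ : Δ₀Formula n → Δ₀Formula n
¬Δ (φ , d) = ¬' φ , d⇒ d d⊥

all< ex< : Term n → Δ₀Formula (suc n) → Δ₀Formula n
all< t (φ , d) = ∀' (v0 ≺ wkT t ⇒ φ) , d∀< t d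
ex<  t (φ , d) = ∃' (v0 ≺ wkT t ∧' φ) , d∃< t d

v7 : Term (8 + n)
v7 = wkT v6
v8 : Term (9 + n)
v8 = wkT v7
v9 : Term (10 + n)
v9 = wkT v8

numeral : ℕ → Term n
numeral zero    = zer
numeral (suc k) = one ⊕ numeral k

pairT : Term n → Term n → Term n
pairT s t = (s ⊕ t) ⊗ (s ⊕ t) ⊕ s

factT : Term n → Term n → Term n → Term n
factT e x y = pairT e (pairT x y)

modulusT : Term n → Term n → Term n
modulusT b i = one ⊕ ((i ⊕ one) ⊗ b)

entryΔ : Term n → Term n → Term n → Term n → Δ₀Formula n
entryΔ a b i m = (m ≺Δ modulusT b i) ∧Δ
  ex< (a ⊕ one) (wkT a ≐Δ (v0 ⊗ wkT (modulusT b i)) ⊕ wkT m)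

memberΔ : Term n → Term n → Term n → Term n → Δ₀Formula n
memberΔ a b l m = ex< l (entryΔ (wkT a) (wkT b) v0 (wkT m))

Member : ℕ → ℕ → ℕ → ℕ → Set
Member a b l m = ∃[ i ] i < l × Entry a b i m

FactIn : ℕ → ℕ → ℕ → ℕ → ℕ → ℕ → Set
FactIn a b l e x y = Member a b l (fact e x y)

arithΔ : Arith → Term n → Term n → Term n → Δ₀Formula n
arithΔ add p q y = y ≐Δ p ⊕ q
arithΔ mul p q y = y ≐Δ p ⊗ q
arithΔ eq  p q y = (p ≐Δ q) ∧Δ (y ≐Δ one) ∨Δ ¬Δ (p ≐Δ q) ∧Δ (y ≐Δ zer)

-- The context starts with the code l, b, a of a list, whose entries are at most a.
all₄ : Δ₀Formula (7 + n) → Δ₀Formula (3 + n)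
all₄ φ = all< (v2 ⊕ one) (all< (v3 ⊕ one) (all< (v4 ⊕ one) (all< (v5 ⊕ one) φ)))

hdΔ tlΔ putΔ exΔ justifiedΔ : Δ₀Formula (3 + n)
binΔ : Arith → Δ₀Formula (3 + n)

hdΔ  = all₄ (memberΔ v6 v5 v4 (factT zer (pairT v2 v1) v0) ⇒Δ v0 ≐Δ v2)
tlΔ  = all₄ (memberΔ v6 v5 v4 (factT (pairT (numeral 1) v3) (pairT v2 v1) v0) ⇒Δ
             memberΔ v6 v5 v4 (factT v3 v1 v0))
putΔ = all₄ (memberΔ v6 v5 v4 (factT (pairT (numeral 2) (pairT v3 v2)) v1 v0) ⇒Δ
             memberΔ v6 v5 v4 (factT v2 (pairT v3 v1) v0))
binΔ o = all₄ (memberΔ v6 v5 v4 (factT (pairT (numeral (4 + index o)) (pairT v3 v2)) v1 v0) ⇒Δ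
               ex< (v6 ⊕ one) (ex< (v7 ⊕ one)
                 (memberΔ v8 v7 v6 (factT v5 v3 v1) ∧Δ memberΔ v8 v7 v6 (factT v4 v3 v0) ∧Δ
                  arithΔ o v1 v0 v2)))
exΔ  = all₄ (memberΔ v6 v5 v4 (factT (pairT (numeral 3) (pairT v3 v2)) v1 v0) ⇒Δ
             ex< (v6 ⊕ one) (memberΔ v7 v6 v5 (factT v4 v2 v0) ∧Δ
               ( v1 ≐Δ one ∧Δ ex< v0 (ex< (v8 ⊕ one)
                   (memberΔ v9 v8 v7 (factT v5 (pairT v1 v4) v0) ∧Δ ¬Δ (v0 ≐Δ zer)))
               ∨Δ v1 ≐Δ zer ∧Δ all< v0 (memberΔ v8 v7 v6 (factT v4 (pairT v0 v3) zer)))))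
justifiedΔ = hdΔ ∧Δ tlΔ ∧Δ putΔ ∧Δ binΔ add ∧Δ binΔ mul ∧Δ binΔ eq ∧Δ exΔ

⊨ : Δ₀Formula n → Vec ℕ n → Set
⊨ φ = Holds (proj₁ φ)

≤⇒<+1 : ∀ {m a} → m ≤ a → m < a + 1
≤⇒<+1 {m} {a} l = subst (m <_) (+-comm 1 a) (s≤s l)

Member-≤ : ∀ {a b l m} → Member a b l m → m ≤ a
Member-≤ {b = b} (i , _ , e) = Entry-≤ {b = b} {i} e

pair-parts : ∀ {a} u w → ⟨ u , w ⟩ ≤ a → u ≤ a × w ≤ a
pair-parts u w h = ≤-trans (⟨,⟩-≥ˡ u w) h , ≤-trans (⟨,⟩-≥ʳ u w) h

FactIn-≤ : ∀ {a b l} e x y → FactIn a b l e x y → e ≤ a × x ≤ a × y ≤ a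
FactIn-≤ {a} {b} {l} e x y s =
  let e≤ , r≤ = pair-parts e ⟨ x , y ⟩ (Member-≤ {a} {b} {l} s) in e≤ , pair-parts x y r≤

-- The bounds `a + 1` lose nothing: entries are remainders of `a`, and a pair is at least as large
-- as its components.
justifiedΔ⇒ : ∀ {a b l} {ρ : Vec ℕ n} → ⊨ justifiedΔ (l ∷ b ∷ a ∷ ρ) → Justified (FactIn a b l)
justifiedΔ⇒ {a = a} {b} {l} (h-hd , h-tl , h-put , h-add , h-mul , h-eq , h-ex) = record
  { j-hd = λ u w y s →
      let _ , x≤ , y≤ = parts 0 ⟨ u , w ⟩ y s
          u≤ , w≤ = pair-parts u w x≤
      in h-hd 0 (≤⇒<+1 z≤n) u (≤⇒<+1 u≤) w (≤⇒<+1 w≤) y (≤⇒<+1 y≤) s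
  ; j-tl = λ c u w y s →
      let e≤ , x≤ , y≤ = parts ⟨ 1 , c ⟩ ⟨ u , w ⟩ y s
          _ , c≤  = pair-parts 1 c e≤
          u≤ , w≤ = pair-parts u w x≤
      in h-tl c (≤⇒<+1 c≤) u (≤⇒<+1 u≤) w (≤⇒<+1 w≤) y (≤⇒<+1 y≤) s
  ; j-put = λ c d w y s →
      let e≤ , x≤ , y≤ = parts ⟨ 2 , ⟨ c , d ⟩ ⟩ w y s
          c≤ , d≤ = pair-parts c d (proj₂ (pair-parts 2 ⟨ c , d ⟩ e≤))
      in h-put c (≤⇒<+1 c≤) d (≤⇒<+1 d≤) w (≤⇒<+1 x≤) y (≤⇒<+1 y≤) s
  ; j-bin = j-bin
  ; j-ex = λ c d w y s →
      let e≤ , x≤ , y≤ = parts ⟨ 3 , ⟨ c , d ⟩ ⟩ w y s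
          c≤ , d≤ = pair-parts c d (proj₂ (pair-parts 3 ⟨ c , d ⟩ e≤))
          p , _ , s′ , r = h-ex c (≤⇒<+1 c≤) d (≤⇒<+1 d≤) w (≤⇒<+1 x≤) y (≤⇒<+1 y≤) s
      in p , s′ , [ (λ { (e , i , i< , z , _ , s″ , ≢0) → inj₁ (e , i , i< , z , s″ , ≢0) }) , inj₂ ]′ r
  }
  where
  parts = FactIn-≤ {a} {b} {l}
  j-bin : ∀ o c d w y → FactIn a b l ⟨ 4 + index o , ⟨ c , d ⟩ ⟩ w y →
    ∃[ p ] ∃[ q ] FactIn a b l c w p × FactIn a b l d w q × ArithSpec o p q y
  j-bin o c d w y s with parts ⟨ 4 + index o , ⟨ c , d ⟩ ⟩ w y s
  ... | e≤ , x≤ , y≤ with pair-parts c d (proj₂ (pair-parts (4 + index o) ⟨ c , d ⟩ e≤))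
  j-bin add c d w y s | _ , x≤ , y≤ | c≤ , d≤ =
    let p , _ , q , _ , r = h-add c (≤⇒<+1 c≤) d (≤⇒<+1 d≤) w (≤⇒<+1 x≤) y (≤⇒<+1 y≤) s in p , q , r
  j-bin mul c d w y s | _ , x≤ , y≤ | c≤ , d≤ =
    let p , _ , q , _ , r = h-mul c (≤⇒<+1 c≤) d (≤⇒<+1 d≤) w (≤⇒<+1 x≤) y (≤⇒<+1 y≤) s in p , q , r
  j-bin eq c d w y s | _ , x≤ , y≤ | c≤ , d≤ =
    let p , _ , q , _ , r = h-eq c (≤⇒<+1 c≤) d (≤⇒<+1 d≤) w (≤⇒<+1 x≤) y (≤⇒<+1 y≤) s in p , q , r

⇒justifiedΔ : ∀ {a b l} {ρ : Vec ℕ n} → Justified (FactIn a b l) → ⊨ justifiedΔ (l ∷ b ∷ a ∷ ρ)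
⇒justifiedΔ {a = a} {b} {l} J =
    (λ _ _ u _ w _ y _ → j-hd u w y)
  , (λ c _ u _ w _ y _ → j-tl c u w y)
  , (λ c _ d _ w _ y _ → j-put c d w y)
  , (λ c _ d _ w _ y _ s → bounded-bin add c d w y s)
  , (λ c _ d _ w _ y _ s → bounded-bin mul c d w y s)
  , (λ c _ d _ w _ y _ s → bounded-bin eq c d w y s)
  , (λ c _ d _ w _ y _ s →
      let p , s′ , r = j-ex c d w y s
      in p , value< c w p s′ , s′ ,
         [ (λ { (e , i , i< , z , s″ , ≢0) → inj₁ (e , i , i< , z , value< d ⟨ i , w ⟩ z s″ , s″ , ≢0) })
         , inj₂ ]′ r)
  where
  open Justified J
  value< : ∀ c w p → FactIn a b l c w p → p < a + 1
  value< c w p s = ≤⇒<+1 (proj₂ (proj₂ (FactIn-≤ {a} {b} {l} c w p s)))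
  bounded-bin : ∀ o c d w y → FactIn a b l ⟨ 4 + index o , ⟨ c , d ⟩ ⟩ w y →
    ∃[ p ] p < a + 1 × ∃[ q ] q < a + 1 × FactIn a b l c w p × FactIn a b l d w q × ArithSpec o p q y
  bounded-bin o c d w y s = let p , q , s₁ , s₂ , r = j-bin o c d w y s in
    p , value< c w p s₁ , q , value< d w q s₂ , s₁ , s₂ , r

callFact : Call → ℕ
callFact (c , ρ) = fact (# c) (encEnv ρ) (eval c ρ)

nth : List Call → ℕ → ℕ
nth []      _       = 0
nth (x ∷ L) zero    = callFact x
nth (x ∷ L) (suc i) = nth L i

∈⇒nth : ∀ {L x} → x ∈ L → ∃[ i ] i < length L × nth L i ≡ callFact x
∈⇒nth (here refl) = 0 , s≤s z≤n , refl
∈⇒nth (there j)   = let i , i< , e = ∈⇒nth j in suc i , s≤s i< , e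

nth-∈ : ∀ L {i} → i < length L → ∃[ x ] x ∈ L × nth L i ≡ callFact x
nth-∈ (x ∷ L) {zero}  _       = x , here refl , refl
nth-∈ (x ∷ L) {suc i} (s≤s l) = let y , j , e = nth-∈ L l in y , there j , e

trace-coded : ∀ c ρ → ∃[ a ] ∃[ b ] ∃[ l ] Justified (FactIn a b l) × FactIn a b l (# c) (encEnv ρ) (eval c ρ)
trace-coded c ρ with trace c ρ
... | L , closed , c∈L with bounded-on-prefix (length L) (nth L)
... | M , M≥ with encode (length L) M (nth L) M≥
... | a , _ , entry = a , b , length L , trace-justified closed source L⇒S , L⇒S c∈L
  where
  b = length L ! * suc M
  L⇒S : ∀ {c ρ} → (c , ρ) ∈ L → FactIn a b (length L) (# c) (encEnv ρ) (eval c ρ)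
  L⇒S j = let i , i< , e = ∈⇒nth j in i , i< , subst (Entry a b i) e (entry i<)
  source : ∀ t u x y → FactIn a b (length L) ⟨ t , u ⟩ x y →
    ∃[ c ] ∃[ ρ ] (c , ρ) ∈ L × t ≡ tag c × u ≡ payload c × x ≡ encEnv ρ × y ≡ eval c ρ
  source t u x y (i , i< , s) =
    let (c , ρ) , j , e = nth-∈ L i<
        e₁ , e₂ , e₃ = fact-injective ⟨ t , u ⟩ x y (# c) (encEnv ρ) (eval c ρ)
                         (trans (Entry-unique {a} {b} {i} s (entry i<)) e)
        e₄ , e₅ = ⟨,⟩-injective t u (tag c) (payload c) e₁
    in c , ρ , j , e₄ , e₅ , e₂ , e₃

-- The five quantifiers: v, the value y of the program e at (v, w), and the code a, b, l of its trace.
witnessΔ : Term n → Term n → Term n → Δ₀Formula n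
witnessΔ e w w′ =
  ex< w′ (ex< (wkT w′) (ex< (wkT (wkT w′)) (ex< (wkT (wkT (wkT w′))) (ex< (wkT (wkT (wkT (wkT w′))))
    (justifiedΔ ∧Δ memberΔ v2 v1 v0 (factT (wk₅ e) (pairT v4 (pairT (wk₅ w) zer)) v3) ∧Δ
     ¬Δ (v3 ≐Δ zer) ∧Δ (wk₅ w ⊕ one) ⊗ (wk₅ w ⊕ one) ≺Δ wk₅ w′)))))
  where
  wk₅ : Term n → Term (5 + n)
  wk₅ t = wkT (wkT (wkT (wkT (wkT t))))

stepΔ : Term n → Term n → Term n → Δ₀Formula n
stepΔ e w w′ = witnessΔ e w w′ ∧Δ all< w′ (¬Δ (witnessΔ (wkT e) (wkT w) v0))

Witness : ℕ → ℕ → ℕ → Set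
Witness e w w′ = ⊨ (witnessΔ v2 v1 v0) (w′ ∷ w ∷ e ∷ [])

record Step (e w w′ : ℕ) : Set where
  constructor step
  field holds : ⊨ (stepΔ v2 v1 v0) (w′ ∷ w ∷ e ∷ [])

witness? : ∀ e w w′ → Dec (Witness e w w′)
witness? e w w′ = holds? (proj₂ (witnessΔ v2 v1 v0)) (w′ ∷ w ∷ e ∷ [])

Witness-sound : ∀ c w w′ → Witness (# c) w w′ →
  (w + 1) * (w + 1) < w′ × ∃[ v ] v < w′ × eval c (v ∷ w ∷ []) ≢ 0
Witness-sound c w w′ (v , v< , y , _ , a , _ , b , _ , l , _ , J , s , y≢0 , sq) =
  sq , v , v< ,
  subst (_≢ 0) (justified-correct (justifiedΔ⇒ {a = a} {b} {l} {y ∷ v ∷ w′ ∷ w ∷ # c ∷ []} J) c (v ∷ w ∷ []) y s) y≢0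

Witness-complete : ∀ c {v w} → eval c (v ∷ w ∷ []) ≢ 0 → ∃[ w′ ] Witness (# c) w w′
Witness-complete c {v} {w} ≢0 with trace-coded c (v ∷ w ∷ [])
... | a , b , l , J , s = w′ ,
  v , s≤s (m≤m⊔n v _) , y , s≤s (≤-trans (m≤m⊔n y _) r₁) , a , s≤s (≤-trans (m≤m⊔n a _) r₂) ,
  b , s≤s (≤-trans (m≤m⊔n b _) r₃) , l , s≤s (≤-trans (m≤m⊔n l _) r₄) ,
  ⇒justifiedΔ {a = a} {b} {l} {y ∷ v ∷ w′ ∷ w ∷ # c ∷ []} J , s , ≢0 , s≤s (≤-trans (m≤n⊔m l sq) r₄)
  where
  y = eval c (v ∷ w ∷ [])
  sq = (w + 1) * (w + 1)
  bound = v ⊔ (y ⊔ (a ⊔ (b ⊔ (l ⊔ sq))))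
  w′ = suc bound
  r₁ : y ⊔ (a ⊔ (b ⊔ (l ⊔ sq))) ≤ bound
  r₁ = m≤n⊔m v _
  r₂ : a ⊔ (b ⊔ (l ⊔ sq)) ≤ bound
  r₂ = ≤-trans (m≤n⊔m y _) r₁
  r₃ : b ⊔ (l ⊔ sq) ≤ bound
  r₃ = ≤-trans (m≤n⊔m a _) r₂
  r₄ : l ⊔ sq ≤ bound
  r₄ = ≤-trans (m≤n⊔m b _) r₃

-- Leastness decides between two candidates. This is what lets `Chain-agrees` identify the entries
-- of a coded chain with those of the chain of an index.
Step-functional : ∀ e {w w′ w″} → Step e w w′ → Step e w w″ → w′ ≡ w″
Step-functional e {w} {w′} {w″} (step (h , least)) (step (h′ , least′)) with <-cmp w′ w″
... | tri< l _ _ = ⊥-elim (least′ w′ l h)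
... | tri≈ _ q _ = q
... | tri> _ _ l = ⊥-elim (least w″ l h′)

least-witness : ∀ {P : ℕ → Set} → (∀ x → Dec (P x)) → ∀ m → P m → ∃[ k ] P k × (∀ x → x < k → ¬ P x)
least-witness P? m p with P? 0
... | yes p₀ = 0 , p₀ , λ _ ()
least-witness P? zero    p | no ¬p₀ = contradiction p ¬p₀
least-witness P? (suc m) p | no ¬p₀ with least-witness (λ x → P? (suc x)) m p
... | k , pk , least = suc k , pk , λ { zero _ → ¬p₀ ; (suc x) (s≤s l) → least x l }

Witness⇒Step : ∀ e w w′ → Witness e w w′ → ∃[ w″ ] Step e w w″
Witness⇒Step e w w′ h =
  let k , hk , least = least-witness (witness? e w) w′ h in k , step (hk , least)

Step-sound : ∀ c {w w′} → Step (# c) w w′ →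
  (w + 1) * (w + 1) < w′ × ∃[ v ] v < w′ × eval c (v ∷ w ∷ []) ≢ 0
Step-sound c {w} {w′} (step s) = Witness-sound c w w′ (proj₁ s)

Step-< : ∀ c {w w′} → Step (# c) w w′ → w < w′
Step-< c {w} s = ≤-<-trans (≤-trans (m≤m+n w 1) (m≤m*m (w + 1))) (proj₁ (Step-sound c s))

Chain : ℕ → ℕ → ℕ → ℕ → ℕ → Set
Chain e c x a b = Entry a b 0 c × (∀ i → i < x → ∃[ w ] w < a + 1 × ∃[ w′ ] w′ < a + 1 ×
  Entry a b i w × Entry a b (i + 1) w′ × Step e w w′)

-- Free variables of chainF: x, c, e (innermost first).
chainΔ : Δ₀Formula 5
chainΔ = entryΔ v1 v0 zer v3 ∧Δ all< v2 (ex< (v2 ⊕ one) (ex< (v3 ⊕ one)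
  (entryΔ v4 v3 v2 v1 ∧Δ entryΔ v4 v3 (v2 ⊕ one) v0 ∧Δ stepΔ v7 v1 v0)))

chainF : Formula 3
chainF = ∃' (∃' (proj₁ chainΔ))

chainF-Σ₁ : SigmaF 1 chainF
chainF-Σ₁ = σ∃ (σ∃ (σΠ (π₀ (proj₂ chainΔ))))

⊨chain : ∀ {a b x c e} → ⊨ chainΔ (b ∷ a ∷ x ∷ c ∷ e ∷ []) → Chain e c x a b
⊨chain (h₀ , h) = h₀ , λ i l → let w , w< , w′ , w′< , s , s′ , r = h i l in w , w< , w′ , w′< , s , s′ , step r

⊨chain⁻ : ∀ {a b x c e} → Chain e c x a b → ⊨ chainΔ (b ∷ a ∷ x ∷ c ∷ e ∷ [])
⊨chain⁻ (h₀ , h) = h₀ , λ i l → let w , w< , w′ , w′< , s , s′ , step r = h i l in w , w< , w′ , w′< , s , s′ , r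

-- Compiling formulas into programs.

Accepts : Code → List ℕ → Set
Accepts c ρ = eval c ρ ≢ 0

bit≢0 : ∀ {P : Set} (d : Dec P) → bit d ≢ 0 → P
bit≢0 (yes p) _  = p
bit≢0 (no _)  ≢0 = contradiction refl ≢0

bit≢0⁻ : ∀ {P : Set} (d : Dec P) → P → bit d ≢ 0
bit≢0⁻ d p e = contradiction (trans (sym e) (bit-yes d p)) λ ()

not : Code → Code
not c = bin eq c (put 0 hd)

not-accepts : ∀ c {ρ} → Accepts (not c) ρ → ¬ Accepts c ρ
not-accepts c h k = k (bit≢0 (_ ≟ _) h)

not-accepts⁻ : ∀ c {ρ} → ¬ Accepts c ρ → Accepts (not c) ρ
not-accepts⁻ c h = bit≢0⁻ (_ ≟ _) (decidable-stable (_ ≟ _) h)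

ex-accepts : ∀ c d {ρ} → Accepts (ex c d) ρ → ∃[ i ] i < eval c ρ × Accepts d (i ∷ ρ)
ex-accepts c d {ρ} = bit≢0 (ex? c d ρ)

ex-accepts⁻ : ∀ c d {ρ} i → i < eval c ρ → Accepts d (i ∷ ρ) → Accepts (ex c d) ρ
ex-accepts⁻ c d {ρ} i l a = bit≢0⁻ (ex? c d ρ) (i , l , a)

all : Code → Code → Code
all c d = not (ex c (not d))

all-accepts : ∀ c d {ρ} → Accepts (all c d) ρ → ∀ i → i < eval c ρ → Accepts d (i ∷ ρ)
all-accepts c d h i l e = not-accepts (ex c (not d)) h
  (ex-accepts⁻ c (not d) i l (not-accepts⁻ d (λ k → k e)))

all-accepts⁻ : ∀ c d {ρ} → (∀ i → i < eval c ρ → Accepts d (i ∷ ρ)) → Accepts (all c d) ρ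
all-accepts⁻ c d h = not-accepts⁻ (ex c (not d)) λ k →
  let i , l , a = ex-accepts c (not d) k in not-accepts d a (h i l)

mul-accepts : ∀ c d {ρ} → Accepts (bin mul c d) ρ → Accepts c ρ × Accepts d ρ
mul-accepts c d {ρ} h = (λ e → h (cong (_* eval d ρ) e))
                      , (λ e → h (trans (cong (eval c ρ *_) e) (*-zeroʳ (eval c ρ))))

mul-accepts⁻ : ∀ c d {ρ} → Accepts c ρ → Accepts d ρ → Accepts (bin mul c d) ρ
mul-accepts⁻ c d h k e = [ h , k ]′ (m*n≡0⇒m≡0∨n≡0 (eval c _) e)

add-accepts : ∀ c d {ρ} → Accepts (bin add c d) ρ → Accepts c ρ ⊎ Accepts d ρ
add-accepts c d {ρ} h with eval c ρ ≟ 0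
... | no ≢0 = inj₁ ≢0
... | yes e = inj₂ (λ e′ → h (cong₂ _+_ e e′))

add-acceptsˡ : ∀ c d {ρ} → Accepts c ρ → Accepts (bin add c d) ρ
add-acceptsˡ c d {ρ} h e = h (m+n≡0⇒m≡0 (eval c ρ) e)

add-acceptsʳ : ∀ c d {ρ} → Accepts d ρ → Accepts (bin add c d) ρ
add-acceptsʳ c d {ρ} h e = h (m+n≡0⇒n≡0 (eval c ρ) e)

_⧺_ : Vec ℕ n → List ℕ → List ℕ
[]      ⧺ σ = σ
(x ∷ ρ) ⧺ σ = x ∷ (ρ ⧺ σ)

lookupC : ℕ → Code
lookupC zero    = hd
lookupC (suc n) = tl (lookupC n)

varC : Fin n → Code
varC zero    = hd
varC (suc i) = tl (varC i)

termC : Term n → Code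
termC (var i) = varC i
termC zer     = put 0 hd
termC one     = put 1 hd
termC (s ⊕ t) = bin add (termC s) (termC t)
termC (s ⊗ t) = bin mul (termC s) (termC t)

formulaC : Δ₀ φ → Code
formulaC d⊥        = put 0 hd
formulaC (d≐ s t)  = bin eq (termC s) (termC t)
-- There is no order test: `s` is below `t` when the search over `i` below `t` meets it. `tl` makes
-- `s` ignore the new entry `i`.
formulaC (d≺ s t)  = ex (termC t) (bin eq hd (tl (termC s)))
formulaC (d∧ d e)  = bin mul (formulaC d) (formulaC e)
formulaC (d∨ d e)  = bin add (formulaC d) (formulaC e)
formulaC (d⇒ d e)  = bin add (not (formulaC d)) (formulaC e)
formulaC (d∀< t d) = all (termC t) (formulaC d)
formulaC (d∃< t d) = ex (termC t) (formulaC d)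

module _ (σ : List ℕ) where

  varC-eval : (ρ : Vec ℕ n) (i : Fin n) → eval (varC i) (ρ ⧺ σ) ≡ lookup ρ i
  varC-eval (x ∷ ρ) zero    = refl
  varC-eval (x ∷ ρ) (suc i) = varC-eval ρ i

  termC-eval : ∀ (t : Term n) ρ → eval (termC t) (ρ ⧺ σ) ≡ val t ρ
  termC-eval (var i) ρ = varC-eval ρ i
  termC-eval zer     ρ = refl
  termC-eval one     ρ = refl
  termC-eval (s ⊕ t) ρ = cong₂ _+_ (termC-eval s ρ) (termC-eval t ρ)
  termC-eval (s ⊗ t) ρ = cong₂ _*_ (termC-eval s ρ) (termC-eval t ρ)

  private
    bound : ∀ (t : Term n) {ρ x d} → x < eval (termC t) (ρ ⧺ σ) → x < val (wkT t) (d ∷ ρ)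
    bound t {ρ} l = <-wkT t (subst (_ <_) (termC-eval t ρ) l)
    bound⁻ : ∀ (t : Term n) {ρ x d} → x < val (wkT t) (d ∷ ρ) → x < eval (termC t) (ρ ⧺ σ)
    bound⁻ t {ρ} l = subst (_ <_) (sym (termC-eval t ρ)) (<-wkT⁻ t l)

  mutual
    formulaC-sound : ∀ {n} {φ : Formula n} (d : Δ₀ φ) → ∀ ρ → Accepts (formulaC d) (ρ ⧺ σ) → Holds φ ρ
    formulaC-sound d⊥ ρ h = h refl
    formulaC-sound (d≐ s t) ρ h =
      trans (sym (termC-eval s ρ)) (trans (bit≢0 (_ ≟ _) h) (termC-eval t ρ))
    formulaC-sound (d≺ s t) ρ h =
      let i , l , e = ex-accepts (termC t) (bin eq hd (tl (termC s))) h
      in subst (_< val t ρ) (trans (bit≢0 (_ ≟ _) e) (termC-eval s ρ)) (subst (i <_) (termC-eval t ρ) l)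
    formulaC-sound (d∧ d e) ρ h =
      let a , b = mul-accepts (formulaC d) (formulaC e) h in formulaC-sound d ρ a , formulaC-sound e ρ b
    formulaC-sound (d∨ d e) ρ h =
      [ inj₁ ∘ formulaC-sound d ρ , inj₂ ∘ formulaC-sound e ρ ]′ (add-accepts (formulaC d) (formulaC e) h)
    formulaC-sound (d⇒ d e) ρ h x =
      [ (λ a → contradiction (formulaC-complete d ρ x) (not-accepts (formulaC d) a))
      , formulaC-sound e ρ ]′ (add-accepts (not (formulaC d)) (formulaC e) h)
    formulaC-sound (d∀< t d) ρ h x l =
      formulaC-sound d (x ∷ ρ) (all-accepts (termC t) (formulaC d) h x (bound⁻ t l))
    formulaC-sound (d∃< t d) ρ h =
      let i , l , a = ex-accepts (termC t) (formulaC d) h in i , bound t l , formulaC-sound d (i ∷ ρ) a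

    formulaC-complete : ∀ {n} {φ : Formula n} (d : Δ₀ φ) → ∀ ρ → Holds φ ρ → Accepts (formulaC d) (ρ ⧺ σ)
    formulaC-complete (d≐ s t) ρ e =
      bit≢0⁻ (_ ≟ _) (trans (termC-eval s ρ) (trans e (sym (termC-eval t ρ))))
    formulaC-complete (d≺ s t) ρ l =
      ex-accepts⁻ (termC t) (bin eq hd (tl (termC s))) (val s ρ)
        (subst (val s ρ <_) (sym (termC-eval t ρ)) l) (bit≢0⁻ (_ ≟ _) (sym (termC-eval s ρ)))
    formulaC-complete (d∧ d e) ρ (x , y) =
      mul-accepts⁻ (formulaC d) (formulaC e) (formulaC-complete d ρ x) (formulaC-complete e ρ y)
    formulaC-complete (d∨ d e) ρ (inj₁ x) = add-acceptsˡ (formulaC d) (formulaC e) (formulaC-complete d ρ x)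
    formulaC-complete (d∨ d e) ρ (inj₂ y) = add-acceptsʳ (formulaC d) (formulaC e) (formulaC-complete e ρ y)
    formulaC-complete (d⇒ d e) ρ f with holds? d ρ
    ... | yes x = add-acceptsʳ (not (formulaC d)) (formulaC e) (formulaC-complete e ρ (f x))
    ... | no ¬x = add-acceptsˡ (not (formulaC d)) (formulaC e)
                    (not-accepts⁻ (formulaC d) (¬x ∘ formulaC-sound d ρ))
    formulaC-complete (d∀< t d) ρ f = all-accepts⁻ (termC t) (formulaC d)
      (λ i l → formulaC-complete d (i ∷ ρ) (f i (bound t l)))
    formulaC-complete (d∃< t d) ρ (x , l , h) =
      ex-accepts⁻ (termC t) (formulaC d) x (bound⁻ t l) (formulaC-complete d (x ∷ ρ) h)

-- Only the unbounded prefix is cut: existential variables range below `v`, universal ones in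
-- `BoundedΠ` below `w`. The Δ₀ matrix keeps its exact meaning.
BoundedΣ : ∀ {n} {φ : Formula n} → SigmaF 1 φ → ℕ → Vec ℕ n → Set
BoundedΣ {φ = φ} (σΠ (π₀ d)) v ρ = Holds φ ρ
BoundedΣ (σ∃ s) v ρ = ∃[ y ] y < v × BoundedΣ s v (y ∷ ρ)

BoundedΠ : ∀ {n} {φ : Formula n} → PiF 2 φ → ℕ → ℕ → Vec ℕ n → Set
BoundedΠ (πΣ s) v w ρ = BoundedΣ s v ρ
BoundedΠ (π∀ p) v w ρ = ∀ x → x < w → BoundedΠ p v w (x ∷ ρ)

-- Programs run in the environment `ρ ⧺ (v ∷ w ∷ [])`. With `n` variables in scope, position `n`
-- holds `v` and position `suc n` holds `w`.
sigmaC : ∀ {n} {φ : Formula n} → SigmaF 1 φ → Code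
sigmaC (σΠ (π₀ d)) = formulaC d
sigmaC {n} (σ∃ s)  = ex (lookupC n) (sigmaC s)

piC : ∀ {n} {φ : Formula n} → PiF 2 φ → Code
piC (πΣ s)     = sigmaC s
piC {n} (π∀ p) = all (lookupC (suc n)) (piC p)

lookupC-eval : ∀ (ρ : Vec ℕ n) σ k → eval (lookupC (n + k)) (ρ ⧺ σ) ≡ eval (lookupC k) σ
lookupC-eval []      σ k = refl
lookupC-eval (x ∷ ρ) σ k = lookupC-eval ρ σ k

module _ (v w : ℕ) where
  private
    σ : List ℕ
    σ = v ∷ w ∷ []
    v≡ : (ρ : Vec ℕ n) → eval (lookupC n) (ρ ⧺ σ) ≡ v
    v≡ {n} ρ = subst (λ k → eval (lookupC k) (ρ ⧺ σ) ≡ v) (+-identityʳ n) (lookupC-eval ρ σ 0)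
    w≡ : (ρ : Vec ℕ n) → eval (lookupC (suc n)) (ρ ⧺ σ) ≡ w
    w≡ {n} ρ = subst (λ k → eval (lookupC k) (ρ ⧺ σ) ≡ w) (+-comm n 1) (lookupC-eval ρ σ 1)

  sigmaC-sound : ∀ {n} {φ : Formula n} (s : SigmaF 1 φ) → ∀ ρ → Accepts (sigmaC s) (ρ ⧺ σ) → BoundedΣ s v ρ
  sigmaC-sound (σΠ (π₀ d)) ρ h = formulaC-sound σ d ρ h
  sigmaC-sound {n = n} (σ∃ s) ρ h =
    let y , l , a = ex-accepts (lookupC n) (sigmaC s) h
    in y , subst (y <_) (v≡ ρ) l , sigmaC-sound s (y ∷ ρ) a

  sigmaC-complete : ∀ {n} {φ : Formula n} (s : SigmaF 1 φ) → ∀ ρ → BoundedΣ s v ρ → Accepts (sigmaC s) (ρ ⧺ σ)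
  sigmaC-complete (σΠ (π₀ d)) ρ h = formulaC-complete σ d ρ h
  sigmaC-complete {n = n} (σ∃ s) ρ (y , l , h) =
    ex-accepts⁻ (lookupC n) (sigmaC s) y (subst (y <_) (sym (v≡ ρ)) l) (sigmaC-complete s (y ∷ ρ) h)

  piC-sound : ∀ {n} {φ : Formula n} (p : PiF 2 φ) → ∀ ρ → Accepts (piC p) (ρ ⧺ σ) → BoundedΠ p v w ρ
  piC-sound (πΣ s) ρ h = sigmaC-sound s ρ h
  piC-sound {n = n} (π∀ p) ρ h x l =
    piC-sound p (x ∷ ρ) (all-accepts (lookupC (suc n)) (piC p) h x (subst (x <_) (sym (w≡ ρ)) l))

  piC-complete : ∀ {n} {φ : Formula n} (p : PiF 2 φ) → ∀ ρ → BoundedΠ p v w ρ → Accepts (piC p) (ρ ⧺ σ)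
  piC-complete (πΣ s) ρ h = sigmaC-complete s ρ h
  piC-complete {n = n} (π∀ p) ρ h = all-accepts⁻ (lookupC (suc n)) (piC p)
    (λ x l → piC-complete p (x ∷ ρ) (h x (subst (x <_) (w≡ ρ) l)))

BoundedΣ-mono : (s : SigmaF 1 φ) → ∀ {v v′ ρ} → v ≤ v′ → BoundedΣ s v ρ → BoundedΣ s v′ ρ
BoundedΣ-mono (σΠ (π₀ d)) l h           = h
BoundedΣ-mono (σ∃ s)      l (y , y< , h) = y , ≤-trans y< l , BoundedΣ-mono s l h

BoundedΠ-mono : (p : PiF 2 φ) → ∀ {v v′ w ρ} → v ≤ v′ → BoundedΠ p v w ρ → BoundedΠ p v′ w ρ
BoundedΠ-mono (πΣ s) l h     = BoundedΣ-mono s l h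
BoundedΠ-mono (π∀ p) l h x b = BoundedΠ-mono p l (h x b)

True⇒BoundedΣ : (s : SigmaF 1 φ) → ∀ {ρ} → True φ ρ → ¬ ¬ (∃[ v ] BoundedΣ s v ρ)
True⇒BoundedΣ (σΠ (π₀ d)) t k = k (0 , True⇒Holds d t)
True⇒BoundedΣ (σ∃ s) t k = t tt λ y _ t′ → True⇒BoundedΣ s t′ λ { (v , h) →
  k (suc y ⊔ v , y , m≤m⊔n (suc y) v , BoundedΣ-mono s (m≤n⊔m (suc y) v) h) }

-- Collection in ℕ: the arguments below `w` are handled one by one, and their bounds are joined by
-- `⊔`, as `BoundedΠ` is monotone in `v`.
True⇒BoundedΠ : (p : PiF 2 φ) → ∀ {ρ} → True φ ρ → ∀ w → ¬ ¬ (∃[ v ] BoundedΠ p v w ρ)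
True⇒BoundedΠ (πΣ s) t w = True⇒BoundedΣ s t
True⇒BoundedΠ (π∀ {φ = φ} p) {ρ} t w = collect w
  where
  collect : ∀ m → ¬ ¬ (∃[ v ] ∀ x → x < m → BoundedΠ p v w (x ∷ ρ))
  collect zero    k = k (0 , λ _ ())
  collect (suc m) k = collect m λ { (v , h) → True⇒BoundedΠ p (t m) w λ { (v′ , h′) →
    k (v ⊔ v′ , λ { x (s≤s x≤m) →
      [ (λ x<m → BoundedΠ-mono p (m≤m⊔n v v′) (h x x<m))
      , (λ { refl → BoundedΠ-mono p (m≤n⊔m v v′) h′ }) ]′ (m≤n⇒m<n∨m≡n x≤m) }) } }

-- Π₂ formulas with standard parameters.

record Requirement : Set where
  constructor req
  field
    {arity}   : ℕ
    {formula} : Formula arity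
    isΠ₂      : PiF 2 formula
    params    : Vec ℕ arity

Satisfied : Requirement → Set
Satisfied (req {formula = φ} p ρ) = True φ ρ

BoundedReq : ℕ → ℕ → Requirement → Set
BoundedReq v w (req p ρ) = BoundedΠ p v w ρ

puts : Vec ℕ n → Code → Code
puts []      c = c
puts (x ∷ ρ) c = puts ρ (put x c)

eval-puts : ∀ (ρ : Vec ℕ n) c σ → eval (puts ρ c) σ ≡ eval c (ρ ⧺ σ)
eval-puts []      c σ = refl
eval-puts (x ∷ ρ) c σ = eval-puts ρ (put x c) σ

-- Multiplication acts as conjunction on accepting values, so one pair `v`, `w` serves all
-- requirements at once.
reqsC : List Requirement → Code
reqsC []             = put 1 hd
reqsC (req p ρ ∷ rs) = bin mul (puts ρ (piC p)) (reqsC rs)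

reqsC-sound : ∀ rs {v w} → Accepts (reqsC rs) (v ∷ w ∷ []) → All (BoundedReq v w) rs
reqsC-sound []             h = []
reqsC-sound (req p ρ ∷ rs) {v} {w} h =
  let a , b = mul-accepts (puts ρ (piC p)) (reqsC rs) h
  in piC-sound v w p ρ (subst (_≢ 0) (eval-puts ρ (piC p) _) a) ∷ reqsC-sound rs b

reqsC-complete : ∀ rs {v w} → All (BoundedReq v w) rs → Accepts (reqsC rs) (v ∷ w ∷ [])
reqsC-complete []             _        = λ ()
reqsC-complete (req p ρ ∷ rs) {v} {w} (h ∷ hs) = mul-accepts⁻ (puts ρ (piC p)) (reqsC rs)
  (subst (_≢ 0) (sym (eval-puts ρ (piC p) _)) (piC-complete v w p ρ h)) (reqsC-complete rs hs)

Satisfied⇒Bounded : ∀ {rs} → All Satisfied rs → ∀ w → ¬ ¬ (∃[ v ] All (BoundedReq v w) rs)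
Satisfied⇒Bounded []                        w k = k (0 , [])
Satisfied⇒Bounded {req p ρ ∷ rs} (t ∷ ts) w k =
  True⇒BoundedΠ p t w λ { (v , h) → Satisfied⇒Bounded ts w λ { (v′ , hs) →
    k (v ⊔ v′ , BoundedΠ-mono p (m≤m⊔n v v′) h ∷ All-mono (m≤n⊔m v v′) hs) } }
  where
  All-mono : ∀ {v v′ rs} → v ≤ v′ → All (BoundedReq v w) rs → All (BoundedReq v′ w) rs
  All-mono l []       = []
  All-mono {rs = req p ρ ∷ _} l (h ∷ hs) = BoundedΠ-mono p l h ∷ All-mono l hs

-- A nonstandard model without Σ₁-induction

module Nonstandard (c : Code) where

  -- `chain` is meaningful only up to `size`. By `start`, the function `size` is also the lowest
  -- chain entry, and thereby an element of the model.
  record Index : Set where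
    field
      size  : ℕ
      chain : ℕ → ℕ
      start : chain 0 ≡ size
      steps : ∀ {j} → j < size → Step (# c) (chain j) (chain (suc j))
  open Index

  chain-< : ∀ i {j} → j < size i → chain i j < chain i (suc j)
  chain-< i l = Step-< c (steps i l)

  chain-mono : ∀ i {j k} → j ≤ k → k ≤ size i → chain i j ≤ chain i k
  chain-mono i {j} {zero}  z≤n _ = ≤-refl
  chain-mono i {j} {suc k} l s = [ (λ { (s≤s l′) → ≤-trans (chain-mono i l′ (<⇒≤ s)) (<⇒≤ (chain-< i s)) })
                                 , (λ { refl → ≤-refl }) ]′ (m≤n⇒m<n∨m≡n l)

  chain-≥ : ∀ i {k} → k ≤ size i → k ≤ chain i k
  chain-≥ i {zero}  _ = z≤n
  chain-≥ i {suc k} s = ≤-<-trans (chain-≥ i (<⇒≤ s)) (chain-< i s)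

  chain-square : ∀ i {k} → k < size i → (chain i k + 1) * (chain i k + 1) < chain i (suc k)
  chain-square i s = proj₁ (Step-sound c (steps i s))

  -- Boolean subsets keep the conditions small, and they suffice because a condition is only ever
  -- cut by a decidable property.
  Subset : Set
  Subset = Index → Bool

  _∈ₛ_ : Index → Subset → Set
  i ∈ₛ p = T (p i)

  _⊆_ : Subset → Subset → Set
  q ⊆ p = ∀ {i} → i ∈ₛ q → i ∈ₛ p

  _∩_ : Subset → {A : Index → Set} → (∀ i → Dec (A i)) → Subset
  (p ∩ A?) i = p i ∧ ⌊ A? i ⌋

  module _ {p : Subset} {A : Index → Set} (A? : ∀ i → Dec (A i)) where
    ∩⁺ : ∀ {i} → i ∈ₛ p → A i → i ∈ₛ (p ∩ A?)
    ∩⁺ {i} x a = Equivalence.from (T-∧ {p i}) (x , fromWitness {a? = A? i} a)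
    ∩⁻ˡ : (p ∩ A?) ⊆ p
    ∩⁻ˡ x = proj₁ (Equivalence.to (T-∧ {p _}) x)
    ∩⁻ʳ : ∀ {i} → i ∈ₛ (p ∩ A?) → A i
    ∩⁻ʳ {i} x = toWitness {a? = A? i} (proj₂ (Equivalence.to (T-∧ {p i}) x))

  -- Validity on `p` up to indices of bounded size. The threshold also ensures that the chain
  -- entries in question exist.
  Almost : Subset → (Index → Set) → Set
  Almost p A = ∃[ K ] ∀ {i} → i ∈ₛ p → K ≤ size i → A i

  private variable
    p q r : Subset
    A B C : Index → Set

  always : (∀ i → A i) → Almost p A
  always f = 0 , λ {i} _ _ → f i

  members : (∀ {i} → i ∈ₛ p → A i) → Almost p A
  members f = 0 , λ x _ → f x

  from-size : ∀ k → (∀ i → k ≤ size i → A i) → Almost p A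
  from-size k f = k , λ {i} _ → f i

  Almost-map : (∀ {i} → A i → B i) → Almost p A → Almost p B
  Almost-map f (K , h) = K , λ x l → f (h x l)

  Almost-map₂ : (∀ {i} → A i → B i → C i) → Almost p A → Almost p B → Almost p C
  Almost-map₂ f (K , h) (L , k) = K ⊔ L , λ x l →
    f (h x (≤-trans (m≤m⊔n K L) l)) (k x (≤-trans (m≤n⊔m K L) l))

  Almost-⊆ : q ⊆ p → Almost p A → Almost q A
  Almost-⊆ s (K , h) = K , λ x → h (s x)

  Almost-∩ : ∀ {p} {A? : ∀ i → Dec (A i)} → Almost (p ∩ A?) B → Almost p (λ i → A i → B i)
  Almost-∩ {p = p} {A? = A?} (K , h) = K , λ x l a → h (∩⁺ {p} A? x a) l

  Negligible : Subset → Set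
  Negligible p = Almost p (λ _ → ⊥)

  -- The hypothesis is applied to the part of `p` where `A` fails: a subset of it on which `A`
  -- almost holds is negligible, so the whole part is.
  Almost-stable : (∀ i → Dec (A i)) →
    (∀ {q} → q ⊆ p → (∀ {r} → r ⊆ q → Almost r A → Negligible r) → Negligible q) → Almost p A
  Almost-stable {A} {p} A? h = Almost-map (λ {i} → decidable-stable (A? i)) (Almost-∩ {A? = ¬A?}
    (h (∩⁻ˡ {p} ¬A?) (λ s → Almost-map₂ (λ ¬a a → ¬a a) (members (λ x → ∩⁻ʳ {p} ¬A? (s x))))))
    where
    ¬A? : ∀ i → Dec (¬ A i)
    ¬A? i = ¬? (A? i)

  record Element : Set where
    field
      at    : Index → ℕ
      level : ℕ
      bound : ∀ i → level ≤ size i → at i ≤ chain i level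
  open Element

  below-chain : ∀ d {i k} → level d ≤ k → k ≤ size i → at d i ≤ chain i k
  below-chain d {i} l s = ≤-trans (bound d i (≤-trans l s)) (chain-mono i l s)

  chainE : ℕ → Element
  chainE k = record { at = λ i → chain i k ; level = k ; bound = λ _ _ → ≤-refl }

  belowE : (f : Index → ℕ) (d : Element) → (∀ i → f i ≤ at d i) → Element
  belowE f d l = record { at = f ; level = level d ; bound = λ i s → ≤-trans (l i) (bound d i s) }

  -- Level `a` suffices because chains increase strictly, so the entry at position `a` is at least
  -- `a`.
  constE : ℕ → Element
  constE a = record { at = λ _ → a ; level = a ; bound = λ i → chain-≥ i }

  -- One further level pays for any operation bounded by a square; this is where the growth
  -- condition in `Step` is used.
  squareE : (f : ℕ → ℕ → ℕ) → (∀ {m n k} → m ≤ k → n ≤ k → f m n ≤ (k + 1) * (k + 1)) →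
    Element → Element → Element
  squareE f f≤ d e = record
    { at    = λ i → f (at d i) (at e i)
    ; level = suc (level d ⊔ level e)
    ; bound = λ i s → ≤-trans (f≤ (below-chain d (m≤m⊔n _ _) (<⇒≤ s)) (below-chain e (m≤n⊔m _ _) (<⇒≤ s)))
                        (<⇒≤ (chain-square i s)) }

  +-square : ∀ {m n k} → m ≤ k → n ≤ k → m + n ≤ (k + 1) * (k + 1)
  +-square {m} {n} {k} l l′ = begin
    m + n              ≤⟨ +-mono-≤ l l′ ⟩
    k + k              ≤⟨ +-mono-≤ (m≤m+n k 1) (≤-trans (m≤m*m k) (*-monoʳ-≤ k (m≤m+n k 1))) ⟩
    (k + 1) + k * (k + 1) ≡⟨ cong (_* (k + 1)) (+-comm 1 k) ⟩
    (k + 1) * (k + 1)  ∎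
    where open ≤-Reasoning

  *-square : ∀ {m n k} → m ≤ k → n ≤ k → m * n ≤ (k + 1) * (k + 1)
  *-square {k = k} l l′ = *-mono-≤ (≤-trans l (m≤m+n k 1)) (≤-trans l′ (m≤m+n k 1))

  frame : Frame
  frame = record
    { Cond = Subset ; _⊑_ = _⊆_ ; ⊑-refl = λ x → x ; ⊑-trans = λ f g x → g (f x)
    ; Bad = Negligible ; Bad-mono = Almost-⊆
    ; D = Element ; 0D = constE 0 ; 1D = constE 1
    ; _+D_ = squareE _+_ +-square ; _*D_ = squareE _*_ *-square
    ; Eq = λ p d e → Almost p (λ i → at d i ≡ at e i)
    ; Lt = λ p d e → Almost p (λ i → at d i < at e i)
    ; Eq-mono = Almost-⊆ ; Lt-mono = Almost-⊆
    ; Eq-stable = Almost-stable (λ _ → _ ≟ _) ; Lt-stable = Almost-stable (λ _ → _ <? _)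
    ; Eq-refl = always (λ _ → refl) ; Eq-sym = Almost-map sym ; Eq-trans = Almost-map₂ trans
    ; Eq-+ = Almost-map₂ (cong₂ _+_) ; Eq-* = Almost-map₂ (cong₂ _*_)
    ; Lt-resp = λ e f l → Almost-map₂ (λ { (e , f) l → subst₂ _<_ e f l }) (Almost-map₂ _,_ e f) l
    }

  open Frame frame using (Forces; ev; Forces-∃I; Forces-∃E; Forces-[]⁻; Forces-subF⁻; Forces-close⁻; sound)

  _‼_ : Vec Element n → Index → Vec ℕ n
  ρ ‼ i = Vec.map (λ d → at d i) ρ

  val-‼ : ∀ (t : Term n) ρ i → val t (ρ ‼ i) ≡ at (ev t ρ) i
  val-‼ (var x) ρ i = lookup-map x (λ d → at d i) ρ
  val-‼ zer     ρ i = refl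
  val-‼ one     ρ i = refl
  val-‼ (s ⊕ t) ρ i = cong₂ _+_ (val-‼ s ρ i) (val-‼ t ρ i)
  val-‼ (s ⊗ t) ρ i = cong₂ _*_ (val-‼ s ρ i) (val-‼ t ρ i)

  module Pick {P : Index → ℕ → Set} (P? : ∀ i x → Dec (P i x)) (d : Element) where
    private
      choose : ∀ {i} → Dec (∃[ x ] x < at d i × P i x) → ℕ
      choose (yes (x , _)) = x
      choose (no _)        = 0
      choose-≤ : ∀ {i} (x : Dec (∃[ x ] x < at d i × P i x)) → choose x ≤ at d i
      choose-≤ (yes (x , l , _)) = <⇒≤ l
      choose-≤ (no _)            = z≤n
      choose-spec : ∀ {i} (x : Dec (∃[ x ] x < at d i × P i x)) → (∃[ x ] x < at d i × P i x) →
        choose x < at d i × P i (choose x)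
      choose-spec (yes (x , l , h)) _ = l , h
      choose-spec (no ¬x)           x = contradiction x ¬x
      some? : ∀ i → Dec (∃[ x ] x < at d i × P i x)
      some? i = anyUpTo? (P? i) (at d i)

    -- A Skolem function for a bounded quantifier. It stays below `d`, so it is again an element;
    -- `0` is the default where the search fails.
    pick : Element
    pick = belowE (λ i → choose (some? i)) d (λ i → choose-≤ (some? i))

    pick-spec : ∀ i → (∃[ x ] x < at d i × P i x) → at pick i < at d i × P i (at pick i)
    pick-spec i = choose-spec (some? i)

  bounded : ∀ (t : Term n) {ρ i x d} → x < val (wkT t) (d ∷ (ρ ‼ i)) → x < at (ev t ρ) i
  bounded t {ρ} {i} {x} l = subst (x <_) (val-‼ t ρ i) (<-wkT⁻ t l)

  bounded⁻ : ∀ (t : Term n) {ρ i x d} → x < at (ev t ρ) i → x < val (wkT t) (d ∷ (ρ ‼ i))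
  bounded⁻ t {ρ} {i} {x} l = <-wkT t (subst (x <_) (sym (val-‼ t ρ i)) l)

  łoś-≺ : ∀ (s t : Term n) {ρ} → Forces p (s ≺ t) ρ → Almost p (λ i → Holds (s ≺ t) (ρ ‼ i))
  łoś-≺ s t {ρ} = Almost-map (λ {i} → subst₂ _<_ (sym (val-‼ s ρ i)) (sym (val-‼ t ρ i)))

  łoś-≺⁻ : ∀ (s t : Term n) {ρ} → Almost p (λ i → Holds (s ≺ t) (ρ ‼ i)) → Forces p (s ≺ t) ρ
  łoś-≺⁻ s t {ρ} = Almost-map (λ {i} → subst₂ _<_ (val-‼ s ρ i) (val-‼ t ρ i))

  mutual
    łoś : ∀ {n} {φ : Formula n} (δ : Δ₀ φ) {p ρ} → Forces p φ ρ → Almost p (λ i → Holds φ (ρ ‼ i))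
    łoś d⊥ x = x
    łoś (d≐ s t) {ρ = ρ} = Almost-map (λ {i} e → trans (val-‼ s ρ i) (trans e (sym (val-‼ t ρ i))))
    łoś (d≺ s t) x = łoś-≺ s t x
    łoś (d∧ δ ε) (x , y) = Almost-map₂ _,_ (łoś δ x) (łoś ε y)
    -- On the part of `p` where the disjunction fails, forcing either disjunct makes a condition
    -- negligible; hence that part is negligible itself.
    łoś (d∨ δ ε) {p} {ρ} x = Almost-map (λ {i} → decidable-stable (holds? (d∨ δ ε) (ρ ‼ i))) (Almost-∩ {A? = none?}
      (x (∩⁻ˡ {p} none?) (λ s y → Almost-map₂ (λ k a → k (inj₁ a)) (members (λ z → ∩⁻ʳ {p} none? (s z))) (łoś δ y))
                     (λ s y → Almost-map₂ (λ k a → k (inj₂ a)) (members (λ z → ∩⁻ʳ {p} none? (s z))) (łoś ε y))))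
      where none? = λ i → ¬? (holds? (d∨ δ ε) (ρ ‼ i))
    łoś (d⇒ δ ε) {p} {ρ} x = Almost-∩ {A? = δ?} (łoś ε (x (∩⁻ˡ {p} δ?) (łoś⁻ δ (members (∩⁻ʳ {p} δ?)))))
      where δ? = λ i → holds? δ (ρ ‼ i)
    -- The forced statement is instantiated at an element choosing a counterexample wherever one
    -- exists; as the matrix holds there too, none exists.
    łoś (d∀< t δ) {p} {ρ} x =
      Almost-map (λ {i} f y l → decidable-stable (holds? δ (y ∷ (ρ ‼ i)))
          λ k → let l′ , k′ = pick-spec i (y , bounded t l , k) in k′ (f (bounded⁻ t l′)))
        (Almost-∩ {A? = inside?} (łoś δ (x pick (∩⁻ˡ {p} inside?) (łoś-≺⁻ v0 (wkT t) (members (∩⁻ʳ {p} inside?))))))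
      where
      open Pick (λ i y → ¬? (holds? δ (y ∷ (ρ ‼ i)))) (ev t ρ)
      inside? = λ i → holds? (d≺ v0 (wkT t)) ((pick ∷ ρ) ‼ i)
    łoś (d∃< t δ) {p} {ρ} x = Almost-map (λ {i} → decidable-stable (holds? (d∃< t δ) (ρ ‼ i))) (Almost-∩ {A? = none?}
      (x (∩⁻ˡ {p} none?) (λ { d s (l , y) → Almost-map₂ (λ { {i} k (l , a) → k (at d i , l , a) })
        (members (λ z → ∩⁻ʳ {p} none? (s z))) (Almost-map₂ _,_ (łoś-≺ v0 (wkT t) l) (łoś δ y)) })))
      where none? = λ i → ¬? (holds? (d∃< t δ) (ρ ‼ i))

    łoś⁻ : ∀ {n} {φ : Formula n} (δ : Δ₀ φ) {p ρ} → Almost p (λ i → Holds φ (ρ ‼ i)) → Forces p φ ρ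
    łoś⁻ d⊥ x = x
    łoś⁻ (d≐ s t) {ρ = ρ} = Almost-map (λ {i} e → trans (sym (val-‼ s ρ i)) (trans e (val-‼ t ρ i)))
    łoś⁻ (d≺ s t) x = łoś-≺⁻ s t x
    łoś⁻ (d∧ δ ε) x = łoś⁻ δ (Almost-map proj₁ x) , łoś⁻ ε (Almost-map proj₂ x)
    łoś⁻ (d∨ δ ε) {p} {ρ} x {q} s f g =
      Almost-map₂ (λ h (k , k′) → [ k , k′ ]′ h) (Almost-⊆ s x) (Almost-map₂ _,_
        (Almost-∩ {A? = δ?} (f (∩⁻ˡ {q} δ?) (łoś⁻ δ (members (∩⁻ʳ {q} δ?)))))
        (Almost-∩ {A? = ε?} (g (∩⁻ˡ {q} ε?) (łoś⁻ ε (members (∩⁻ʳ {q} ε?))))))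
      where δ? = λ i → holds? δ (ρ ‼ i)
            ε? = λ i → holds? ε (ρ ‼ i)
    łoś⁻ (d⇒ δ ε) x s y = łoś⁻ ε (Almost-map₂ (λ f a → f a) (Almost-⊆ s x) (łoś δ y))
    łoś⁻ (d∀< t δ) x d s y = łoś⁻ δ (Almost-map₂ (λ {i} f l → f (at d i) l) (Almost-⊆ s x) (łoś-≺ v0 (wkT t) y))
    -- A witness is chosen at every index, and `q` is cut to the indices where the choice is good.
    łoś⁻ (d∃< t δ) {p} {ρ} x {q} s k =
      Almost-map₂ (λ { {i} (y , l , a) f →
          let l′ , a′ = pick-spec i (y , bounded t l , a) in f (bounded⁻ t l′ , a′) })
        (Almost-⊆ s x)
        (Almost-∩ {A? = good?} (k pick (∩⁻ˡ {q} good?)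
          ( łoś-≺⁻ v0 (wkT t) (members (λ z → proj₁ (∩⁻ʳ {q} good? z)))
          , łoś⁻ δ (members (λ z → proj₂ (∩⁻ʳ {q} good? z))))))
      where
      open Pick (λ i y → holds? δ (y ∷ (ρ ‼ i))) (ev t ρ)
      good? = λ i → holds? (d∧ (d≺ v0 (wkT t)) δ) ((pick ∷ ρ) ‼ i)

  valid : Δ₀-Valid frame
  valid δ h p ρ = łoś⁻ δ (always (λ i → h (ρ ‼ i)))

  BoundedΣ? : ∀ {n} {φ : Formula n} (s : SigmaF 1 φ) v ρ → Dec (BoundedΣ s v ρ)
  BoundedΣ? (σΠ (π₀ δ)) v ρ = holds? δ ρ
  BoundedΣ? (σ∃ s)      v ρ = anyUpTo? (λ y → BoundedΣ? s v (y ∷ ρ)) v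

  forces-Σ₁ : ∀ {n} {φ : Formula n} (s : SigmaF 1 φ) {ρ} (V : Element) →
    Almost p (λ i → BoundedΣ s (at V i) (ρ ‼ i)) → Forces p φ ρ
  forces-Σ₁ (σΠ (π₀ δ)) V h = łoś⁻ δ h
  forces-Σ₁ (σ∃ {φ = φ} s) {ρ} V h = Forces-∃I {φ = φ} pick
    (forces-Σ₁ s V (Almost-map (λ {i} x → proj₂ (pick-spec i x)) h))
    where open Pick (λ i y → BoundedΣ? s (at V i) (y ∷ (ρ ‼ i))) V

  -- Each universal argument `d` raises `k₀` strictly above its level, so that finally all arguments
  -- lie below one entry `chain i k`. The next entry is an element of the model and bounds the
  -- witnesses.
  forces-Π₂ : ∀ {n} {φ : Formula n} (π : PiF 2 φ) {ρ} k₀ →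
    (∀ k → k₀ ≤ k → Almost p (λ i → BoundedΠ π (chain i (suc k)) (chain i k) (ρ ‼ i))) → Forces p φ ρ
  forces-Π₂ (πΣ s) k₀ h = forces-Σ₁ s (chainE (suc k₀)) (h k₀ ≤-refl)
  forces-Π₂ (π∀ π) {ρ} k₀ h d = forces-Π₂ π (k₀ ⊔ suc (level d)) λ k l →
    Almost-map₂ (λ {i} f x< → f (at d i) x<) (h k (≤-trans (m≤m⊔n k₀ _) l))
      (from-size k (λ i s → below-level i (≤-trans (m≤n⊔m k₀ _) l) s))
    where
    below-level : ∀ i {k} → level d < k → k ≤ size i → at d i < chain i k
    below-level i {suc k} (s≤s l) s = ≤-<-trans (below-chain d l (<⇒≤ s)) (chain-< i s)

  consts : Vec ℕ n → Vec Element n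
  consts = Vec.map constE

  consts-‼ : ∀ (ρ : Vec ℕ n) i → consts ρ ‼ i ≡ ρ
  consts-‼ []      i = refl
  consts-‼ (x ∷ ρ) i = cong (x ∷_) (consts-‼ ρ i)

  ForcedReq : Subset → Requirement → Set
  ForcedReq p (req {formula = φ} _ ρ) = Forces p φ (consts ρ)

  forces-requirements : ∀ {rs} → c ≡ reqsC rs → ∀ p → All (ForcedReq p) rs
  forces-requirements {rs} c≡ p = All.tabulate λ { {req π ρ} r∈ → forces-Π₂ π 0 λ k _ →
    from-size (suc k) λ i s →
      let _ , v , v< , acc = Step-sound c (steps i s)
          all = reqsC-sound rs (subst (λ c → Accepts c (v ∷ chain i k ∷ [])) c≡ acc)
      in BoundedΠ-mono π (<⇒≤ v<)
           (subst (BoundedΠ π v (chain i k)) (sym (consts-‼ ρ i)) (All.lookup all r∈)) }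

  -- chainF defines the standard cut: the length of a chain inside the model is bounded by a
  -- standard number, because a chain of length k + 1 already leaves the k-th level.
  programE sizeE : Element
  programE = constE (# c)
  sizeE    = chainE 0

  Chain-agrees : ∀ i {x a b} → Chain (# c) (chain i 0) x a b → ∀ j → j ≤ x → j ≤ size i →
    Entry a b j (chain i j)
  Chain-agrees i (h₀ , h) zero    _ _ = h₀
  Chain-agrees i {x} {a} {b} (h₀ , h) (suc j) j<x s with h j j<x
  ... | w , _ , w′ , _ , ew , ew′ , st
    with Entry-unique {a} {b} {j} (Chain-agrees i (h₀ , h) j (<⇒≤ j<x) (<⇒≤ s)) ew
  ... | refl = subst₂ (Entry a b) (+-comm j 1) (Step-functional (# c) st (steps i s)) ew′

  Chain-length : ∀ i {x a b k} → Chain (# c) (chain i 0) x a b → a ≤ chain i k → k < size i → x ≤ k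
  Chain-length i {x} {a} {b} {k} h a≤ k<s = ≮⇒≥ λ k<x → <⇒≱ (chain-< i k<s)
    (≤-trans (Entry-≤ {b = b} {suc k} (Chain-agrees i h (suc k) k<x k<s)) a≤)

  chainF-bounded : ∀ {x a b} → Forces p (proj₁ chainΔ) (b ∷ a ∷ x ∷ sizeE ∷ programE ∷ []) →
    ∃[ k ] Almost p (λ i → at x i ≤ k)
  chainF-bounded {x = x} {a} {b} f = level a ,
    Almost-map₂ (λ {i} h s → Chain-length i (⊨chain {at a i} {at b i} {at x i} h) (below-chain a ≤-refl (<⇒≤ s)) s)
      (łoś (proj₂ chainΔ) {ρ = b ∷ a ∷ x ∷ sizeE ∷ programE ∷ []} f) (from-size (suc (level a)) (λ _ s → s))

  module Code-of-chain (k : ℕ) where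
    private
      l : ℕ
      l = suc k

    -- The code of the chain up to entry `k` must belong to the model. `b` and the product of the
    -- moduli are rebuilt with the operations of the model and so get a level automatically; `aE`
    -- lies below that product.
    bE : Element
    bE = Frame._*D_ frame (constE (l !)) (Frame._+D_ frame (constE 1) (chainE k))

    productE : ℕ → Element
    productE zero    = constE 1
    productE (suc j) = Frame._*D_ frame (Frame._+D_ frame (constE 1) (Frame._*D_ frame (constE (j + 1)) bE)) (productE j)

    productE-at : ∀ j i → at (productE j) i ≡ moduli-product (at bE i) j
    productE-at zero    i = refl
    productE-at (suc j) i = cong (modulus (at bE i) j *_) (productE-at j i)

    encoding : ∀ i → k ≤ size i → ∃[ a ] a < moduli-product (at bE i) l ×
      (∀ {j} → j < l → Entry a (at bE i) j (chain i j))
    encoding i s = encode l (chain i k) (chain i) (λ { {j} (s≤s j≤k) → chain-mono i {j} {k} j≤k s })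

    code : ∀ i → Dec (k ≤ size i) → ℕ
    code i (yes s) = proj₁ (encoding i s)
    -- Indices shorter than `k` do not count for `Almost`; `0` merely respects the bound.
    code i (no _)  = 0

    code-≤ : ∀ i s? → code i s? ≤ at (productE l) i
    code-≤ i (yes s) = subst (code i (yes s) ≤_) (sym (productE-at l i)) (<⇒≤ (proj₁ (proj₂ (encoding i s))))
    code-≤ i (no _)  = z≤n

    aE : Element
    aE = belowE (λ i → code i (k ≤? size i)) (productE l) (λ i → code-≤ i (k ≤? size i))

    entries : ∀ i → k ≤ size i → ∀ {j} → j < l → Entry (at aE i) (at bE i) j (chain i j)
    entries i s with k ≤? size i
    ... | yes s′ = proj₂ (proj₂ (encoding i s′))
    ... | no ¬s  = contradiction s ¬s

    is-chain : ∀ i → k ≤ size i → ∀ {x} → x ≤ k → Chain (# c) (chain i 0) x (at aE i) (at bE i)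
    is-chain i s {x} x≤k = entries i s (s≤s z≤n) , λ j j<x →
      let j<k = ≤-trans j<x x≤k
          e₁  = entries i s (m≤n⇒m≤1+n j<k)
          e₂  = entries i s (s≤s j<k)
      in chain i j , ≤⇒<+1 (Entry-≤ {b = at bE i} {j} e₁)
       , chain i (suc j) , ≤⇒<+1 (Entry-≤ {b = at bE i} {suc j} e₂)
       , e₁ , subst (λ z → Entry (at aE i) (at bE i) z (chain i (suc j))) (+-comm 1 j) e₂
       , steps i (≤-trans j<k s)

  chainF-standard : ∀ k {x} → Almost p (λ i → at x i ≤ k) → Forces p chainF (x ∷ sizeE ∷ programE ∷ [])
  chainF-standard k {x} h =
    Forces-∃I {φ = ∃' (proj₁ chainΔ)} {x ∷ sizeE ∷ programE ∷ []} aE (Forces-∃I {φ = proj₁ chainΔ} {aE ∷ x ∷ sizeE ∷ programE ∷ []} bE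
      (łoś⁻ (proj₂ chainΔ) {ρ = bE ∷ aE ∷ x ∷ sizeE ∷ programE ∷ []} (Almost-map₂ (λ {i} x≤k s → ⊨chain⁻ {at aE i} {at bE i} {at x i} (is-chain i s x≤k)) h (from-size k (λ _ s → s)))))
    where open Code-of-chain k

  -- The standard bound `k` comes from codes that exist only locally and negatively. It is therefore
  -- not extracted but passed, on a smaller condition, to the proof of a stable conclusion.
  chainF-elim : ∀ {m} (χ : Formula m) {x ρ} → Forces p chainF (x ∷ sizeE ∷ programE ∷ []) →
    (∀ k {q} → q ⊆ p → Almost q (λ i → at x i ≤ k) → Forces q χ ρ) → Forces p χ ρ
  chainF-elim χ {x} {ρ} f g = Forces-∃E {φ = ∃' (proj₁ chainΔ)} χ {x ∷ sizeE ∷ programE ∷ []} {ρ} f λ a s f′ →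
    Forces-∃E {φ = proj₁ chainΔ} χ {a ∷ x ∷ sizeE ∷ programE ∷ []} {ρ} f′ λ b s′ f″ →
      let k , h = chainF-bounded {x = x} {a} {b} f″ in g k (λ z → s (s′ z)) h

  -- The premises hold because a bound `k` on the length becomes `k + 1`. The conclusion at `sizeE`
  -- would bound `size` by a standard number on parts of `p`, which makes those parts negligible and
  -- hence `p`.
  induction-fails : Forces p (Ind chainF) (sizeE ∷ programE ∷ []) → Negligible p
  induction-fails {p} I = chainF-elim {p = p} ⊥' {sizeE} {[]} (I {p} (λ z → z) (zero-case , step-case) sizeE)
    λ k {q} _ h → Almost-map₂ {p = q} (λ {i} x≤k s → <⇒≱ s (subst (_≤ k) (Index.start i) x≤k)) h (from-size (suc k) (λ _ s → s))
    where
    zero-case : Forces p (chainF [ zer ]) (sizeE ∷ programE ∷ [])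
    zero-case = Forces-[]⁻ {p = p} chainF zer {sizeE ∷ programE ∷ []} (chainF-standard {p = p} 0 {constE 0} (always (λ _ → z≤n)))
    step-case : Forces p (∀' (chainF ⇒ subF succSub chainF)) (sizeE ∷ programE ∷ [])
    step-case x {q} s f = Forces-subF⁻ {p = q} {σ = succSub} {ρ = x ∷ sizeE ∷ programE ∷ []} {ρ′ = Frame._+D_ frame x (constE 1) ∷ sizeE ∷ programE ∷ []}
      (λ { zero → refl ; (suc zero) → refl ; (suc (suc zero)) → refl }) chainF
      (chainF-elim {p = q} chainF {x} {Frame._+D_ frame x (constE 1) ∷ sizeE ∷ programE ∷ []} f (λ k {r} _ h → chainF-standard {p = r} (k + 1) {Frame._+D_ frame x (constE 1)} (Almost-map (+-monoˡ-≤ 1) h)))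

-- Refuting a Σ₃ axiomatization.

open Nonstandard using (Index; Subset; Negligible; ForcedReq; consts; constE)

indices : ∀ {rs} → All Satisfied rs → ∀ K n →
  ¬ ¬ (Σ (ℕ → ℕ) λ g → g 0 ≡ n × (∀ {j} → j < K → Step (# (reqsC rs)) (g j) (g (suc j))))
indices sat zero    n k = k ((λ _ → n) , refl , λ ())
indices {rs} sat (suc K) n k = Satisfied⇒Bounded sat n λ { (v , b) →
  let w , wit = Witness-complete (reqsC rs) {v} {n} (reqsC-complete rs b)
      w′ , st = Witness⇒Step (# (reqsC rs)) n w wit
  in indices sat K w′ λ { (g , g0 , h) →
       k ( (λ { zero → n ; (suc j) → g j }) , refl
         , λ { {zero} _ → subst (Step _ n) (sym g0) st ; {suc j} (s≤s l) → h l }) } }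

-- Chains of every finite length exist from every start. For a threshold `K`, the one of length `K`
-- from `K` is an index that the threshold does not exclude.
not-negligible : ∀ {rs} → All Satisfied rs → ¬ Negligible (reqsC rs) (λ _ → true)
not-negligible sat (K , h) = indices sat K K λ { (g , g0 , st) →
  h {record { size = K ; chain = g ; start = g0 ; steps = st }} tt ≤-refl }

-- Uniform in `c`, because a requirement is found for each axiom before the program is assembled
-- from all of them.
Sufficient : ∀ {n} → Formula n → Vec ℕ n → Requirement → Set
Sufficient φ ρ r = ∀ c p → ForcedReq c p r → Frame.Forces (Nonstandard.frame c) p φ (consts c ρ)

Σ₃-requirement : ∀ {n} {φ : Formula n} → SigmaF 3 φ → ∀ ρ → True φ ρ → ¬ ¬ (∃[ r ] Satisfied r × Sufficient φ ρ r)
Σ₃-requirement (σΠ p) ρ t k = k (req p ρ , t , λ _ _ f → f)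
Σ₃-requirement (σ∃ {φ = φ} s) ρ t k = t tt λ a _ t′ → Σ₃-requirement s (a ∷ ρ) t′ λ { (r , sat , suff) →
  k (r , sat , λ c p f → Frame.Forces-∃I (Nonstandard.frame c) {φ = φ} (constE c a) (suff c p f)) }

not-Σ₃ : ¬ Σ Theory (λ A → (∀ φ → A φ → SigmaF 3 φ) × ((Pminus ∪ A) ≡ₜ PΣ₁))
not-Σ₃ (A , isΣ₃ , sound , complete) =
  -- The derivation comes first: `chainF` leaves the program open, so `c` may be built from the
  -- axioms in `Γ`.
  let Γ , Γ⊆ , d = complete _ (baseI (ind chainF chainF-Σ₁)) in
  requirements Γ⊆ λ { (rs , sat , suff) →
    let c = reqsC rs
        open Nonstandard c using (induction-fails; forces-requirements; frame; sizeE; programE)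
        full = λ _ → true
        I = Frame.sound frame {p = full} d (suff c full (forces-requirements {rs} refl full))
    in not-negligible sat (induction-fails {full}
         (Frame.Forces-close⁻ frame 2 (Ind chainF) I (sizeE ∷ programE ∷ []))) }
  where
  requirements : ∀ {Γ} → All (Pminus ∪ A) Γ →
    ¬ ¬ (∃[ rs ] All Satisfied rs × (∀ c p → All (ForcedReq c p) rs →
           All (λ ψ → Frame.Forces (Nonstandard.frame c) p ψ []) Γ))
  requirements [] k = k ([] , [] , λ _ _ _ → [])
  requirements (inj₁ a ∷ Γ⊆) k = requirements Γ⊆ λ { (rs , sat , suff) →
    k (rs , sat , λ c p f →
      forces-Pminus (Nonstandard.frame c) (Nonstandard.valid c) a p ∷ suff c p f) }
  requirements {φ ∷ _} (inj₂ a ∷ Γ⊆) k = requirements Γ⊆ λ { (rs , sat , suff) →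
    Σ₃-requirement (isΣ₃ φ a) [] (PΣ₁-theorems-true (sound φ (inj₂ a))) λ { (r , sat₁ , suff₁) →
      k (r ∷ rs , sat₁ ∷ sat , λ { c p (f ∷ fs) → suff₁ c p f ∷ suff c p fs }) } }

theorem2p2 : Σ Theory (λ A → (∀ φ → A φ → PiF 3 φ) × (A ≡ₜ PΣ₁))
    × ¬ Σ Theory (λ A → (∀ φ → A φ → SigmaF 3 φ) × ((Pminus ∪ A) ≡ₜ PΣ₁))
theorem2p2 = Π3-axiomatization , not-Σ₃
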